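{- Let $G=(V,E)$ be a signed graph which is chordal as a non-signed graph. Then $G$ is signed-eliminable if and only if both of the following conditions hold: (C2) For every $\sigma\in\{+,-\}$ and every four distinct vertices $u,v,w,x$ of $G$ with $uv\in E_\sigma$, $vw\in E_{ -\sigma}$, $wx\in E_\sigma$, we have either ($uw\in E_\sigma$ and $ux\in E_\sigma$) or ($ux\in E_\sigma$ and $vx\in E_\sigma$). (C3) $G$ contains no mountain and no hill as an induced subgraph.
   Context: All graphs are finite, simple and undirected. A signed graph is a graph $G=(V,E)$ together with a partition $E=E_+\sqcup E_-$ (either part may be empty); $-\sigma$ denotes the sign opposite to $\sigma\in\{+,-\}$. Induced subgraphs of a signed graph inherit the signs. A graph is chordal if it has no induced cycle of length at least four. An ordering on $G$ is a bijection $\nu:V\to\{1,\dots,|V|\}$. It is a signed elimination ordering (SEO) if for every triple $(u,v,w)$ of distinct vertices with $\nu(u)<\nu(w)>\nu(v)$ and each $\sigma\in\{+,-\}$: (E1) if $uw,wv\in E_\sigma$ then $uv\in E_\sigma$; (E2) if $uv\in E_\sigma$ and $vw\in E_{ -\sigma}$ then $uw\in E_\sigma$. $G$ is signed-eliminable if it admits a SEO. A mountain is a signed graph for which there are $\sigma\in\{+,-\}$ and an enumeration $(v_1,\dots,v_n;w)$ of its (distinct) vertices, $n\ge 3$, such that $v_iv_{i+1}\in E_{ -\sigma}$ for $1\le i\le n-1$, $wv_i\in E_\sigma$ for $2\le i\le n-1$, and no other pair of vertices is joined by an edge. A hill is a signed graph for which there are $\sigma\in\{+,-\}$ and an enumeration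 $(v_1,\dots,v_n;w_1,w_2)$ of its (distinct) vertices, $n\ge 2$, such that $v_iv_{i+1}\in E_{ -\sigma}$ for $1\le i\le n-1$, $w_1w_2\in E_\sigma$, $w_1v_i\in E_\sigma$ for $1\le i\le n-1$, $w_2v_i\in E_\sigma$ for $2\le i\le n$, and no other pair of vertices is joined by an edge. -}

module Defs where

open import Level using (0ℓ)
open import Data.Nat using (ℕ; suc; _≤_; _<_)
open import Data.Fin as Fin using (Fin; toℕ)
open import Data.Fin.Patterns using (0F; 1F)
open import Data.Product using (∃-syntax; Σ-syntax; _×_)
open import Data.Sign using (Sign; opposite) renaming (+ to ⊕; - to ⊖)
open import Data.Sum using (_⊎_; inj₁; inj₂)
open import Function using (_⇔_; _⤖_; _↣_; Bijection; Injection)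
open import Relation.Binary using (Rel; Decidable; Symmetric; Irreflexive)
open import Relation.Binary.Construct.Closure.Symmetric using (SymClosure)
open import Relation.Binary.PropositionalEquality using (_≡_; _≢_; refl)
open import Relation.Nullary using (¬_)

-- A finite set of edges is decidable; constructively this has to be stated.
record Graph (n : ℕ) : Set₁ where
  field
    Adj        : Rel (Fin n) 0ℓ
    Adj?       : Decidable Adj
    Adj-sym    : Symmetric Adj
    Adj-irrefl : Irreflexive _≡_ Adj

record SignedGraph (n : ℕ) : Set₁ where
  field
    graph    : Graph n
  open Graph graph public
  field
    E        : Sign → Rel (Fin n) 0ℓ
    E?       : ∀ σ → Decidable (E σ)
    E-sym    : ∀ σ → Symmetric (E σ)
    cover    : ∀ u v → Adj u v ⇔ (E ⊕ u v ⊎ E ⊖ u v)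
    disjoint : ∀ u v → ¬ (E ⊕ u v × E ⊖ u v)

open SignedGraph using (graph; E)

-- An induced subgraph on k vertices is given by an injection of its vertices
-- into those of the ambient graph.
inducedGraph : ∀ {n k} → Graph n → (Fin k ↣ Fin n) → Graph k
inducedGraph G ι = record
  { Adj        = λ i j → Adj (to i) (to j)
  ; Adj?       = λ i j → Adj? (to i) (to j)
  ; Adj-sym    = Adj-sym
  ; Adj-irrefl = λ { refl → Adj-irrefl refl }
  }
  where
  open Graph G
  open Injection ι using (to)

induced : ∀ {n k} → SignedGraph n → (Fin k ↣ Fin n) → SignedGraph k
induced G ι = record
  { graph    = inducedGraph G.graph ι
  ; E        = λ σ i j → G.E σ (to i) (to j)
  ; E?       = λ σ i j → G.E? σ (to i) (to j)
  ; E-sym    = λ σ → G.E-sym σ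
  ; cover    = λ i j → G.cover (to i) (to j)
  ; disjoint = λ i j → G.disjoint (to i) (to j)
  }
  where
  module G = SignedGraph G
  open Injection ι using (to)

data CycleStep {k : ℕ} : Rel (Fin k) 0ℓ where
  next  : ∀ {i j} → toℕ j ≡ suc (toℕ i) → CycleStep i j
  close : ∀ {i j} → suc (toℕ i) ≡ k → toℕ j ≡ 0 → CycleStep i j

-- Meaningful as "H is a k-cycle" only for k ≥ 3; used below for k ≥ 4.
IsCycle : ∀ {k} → Graph k → Set
IsCycle {k} H =
  Σ[ c ∈ (Fin k ⤖ Fin k) ] let open Bijection c using (to) in
    ∀ i j → Graph.Adj H (to i) (to j) ⇔ SymClosure CycleStep i j

Chordal : ∀ {n} → Graph n → Set
Chordal {n} G =
  ∀ k → 4 ≤ k → (ι : Fin k ↣ Fin n) → ¬ IsCycle (inducedGraph G ι)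

Ordering : ℕ → Set
Ordering n = Fin n ⤖ Fin n

IsSEO : ∀ {n} → SignedGraph n → Ordering n → Set
IsSEO G ordering = ∀ u v w → u ≢ v → u ≢ w → v ≢ w →
  ν u Fin.< ν w → ν v Fin.< ν w → ∀ σ →
    (E G σ u w → E G σ w v → E G σ u v)
  × (E G σ u v → E G (opposite σ) v w → E G σ u w)
  where open Bijection ordering using () renaming (to to ν)

SignedEliminable : ∀ {n} → SignedGraph n → Set
SignedEliminable G = ∃[ ν ] IsSEO G ν

-- An enumeration (v₁,…,vₙ; w₁,…,wₖ) of the m vertices is a bijection
-- (Fin n ⊎ Fin k) ⤖ Fin m.  Indices are shifted: inj₁ i is v_{i+1}, inj₂ j is
-- w_{j+1}.
data PathEdge {n k : ℕ} : Rel (Fin n ⊎ Fin k) 0ℓ where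
  step : ∀ {i j} → toℕ j ≡ suc (toℕ i) → PathEdge (inj₁ i) (inj₁ j)

data MountainEdge {n : ℕ} : Rel (Fin n ⊎ Fin 1) 0ℓ where
  spoke : ∀ {i} → 1 ≤ toℕ i → suc (toℕ i) < n → MountainEdge (inj₂ 0F) (inj₁ i)

data HillEdge {n : ℕ} : Rel (Fin n ⊎ Fin 2) 0ℓ where
  top    : HillEdge (inj₂ 0F) (inj₂ 1F)
  spoke₁ : ∀ {i} → suc (toℕ i) < n → HillEdge (inj₂ 0F) (inj₁ i)
  spoke₂ : ∀ {i} → 1 ≤ toℕ i → HillEdge (inj₂ 1F) (inj₁ i)

-- The equivalences say that the listed pairs carry the given sign and, as
-- σ and its opposite are the only signs, that no other pair is an edge.
IsMountain : ∀ {m} → SignedGraph m → Set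
IsMountain {m} H =
  ∃[ σ ] ∃[ n ] 3 ≤ n × (Σ[ e ∈ ((Fin n ⊎ Fin 1) ⤖ Fin m) ]
    let open Bijection e using (to) in
      (∀ x y → E H (opposite σ) (to x) (to y) ⇔ SymClosure PathEdge x y)
    × (∀ x y → E H σ (to x) (to y) ⇔ SymClosure MountainEdge x y))

IsHill : ∀ {m} → SignedGraph m → Set
IsHill {m} H =
  ∃[ σ ] ∃[ n ] 2 ≤ n × (Σ[ e ∈ ((Fin n ⊎ Fin 2) ⤖ Fin m) ]
    let open Bijection e using (to) in
      (∀ x y → E H (opposite σ) (to x) (to y) ⇔ SymClosure PathEdge x y)
    × (∀ x y → E H σ (to x) (to y) ⇔ SymClosure HillEdge x y))

C2 : ∀ {n} → SignedGraph n → Set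
C2 G = ∀ σ u v w x →
  u ≢ v → u ≢ w → u ≢ x → v ≢ w → v ≢ x → w ≢ x →
  E G σ u v → E G (opposite σ) v w → E G σ w x →
  (E G σ u w × E G σ u x) ⊎ (E G σ u x × E G σ v x)

C3 : ∀ {n} → SignedGraph n → Set
C3 {n} G = ∀ k (ι : Fin k ↣ Fin n) →
  ¬ IsMountain (induced G ι) × ¬ IsHill (induced G ι)

{-# OPTIONS --safe #-}
module Submission where

open import Level using (0ℓ)
open import Data.Empty using (⊥; ⊥-elim)
open import Data.Nat as ℕ using (ℕ; zero; suc; z≤n; s≤s; _≤_; _<_)
import Data.Nat.Properties as ℕ
open import Data.Fin as Fin
  using (Fin; zero; suc; toℕ; fromℕ; fromℕ<; splitAt; join; punchIn; punchOut)
open import Data.Fin.Patterns using (0F; 1F; 2F; 3F)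
open import Data.Fin.Permutation using (Permutation; _⟨$⟩ʳ_; insert; insert-punchIn)
open import Data.Fin.Properties
  using (_≟_; any?; all?; toℕ-injective; toℕ-fromℕ; toℕ-fromℕ<; toℕ-inject₁; toℕ<n; toℕ≤pred[n];
         suc-injective; +↔⊎; join-splitAt; splitAt-join; ≤fromℕ;
         punchIn-injective; punchIn-punchOut; punchIn-mono-≤)
open import Data.Fin.Subset using (Subset; _∈_; _∉_; _⊆_; _⊂_; _⊃_; _∪_; ⁅_⁆)
open import Data.Fin.Subset.Induction using (Acc; acc; ⊂-wellFounded; ⊃-wellFounded)
open import Data.Fin.Subset.Properties
  using (_∈?_; x∈⁅x⁆; x∈⁅y⁆⇒x≡y; p⊆p∪q; q⊆p∪q; x∈p∪q⁻)
open import Data.Product using (∃; ∃₂; _×_; _,_; proj₁; proj₂)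
open import Data.Sign using (Sign; opposite) renaming (+ to ⊕; - to ⊖)
open import Data.Sign.Properties using (opposite-selfInverse)
open import Data.Sum using (_⊎_; inj₁; inj₂; [_,_]′)
open import Data.Vec using (tabulate)
open import Data.Vec.Functional using () renaming (_∷_ to _∷ᶠ_)
open import Data.Vec.Properties using (lookup∘tabulate; lookup⇒[]=; []=⇒lookup)
open import Function
  using (_∘_; id; _⇔_; _⤖_; _↣_; mk⇔; mk↣; Bijection; Equivalence; Injection; Injective)
open import Function.Construct.Composition using (_↣-∘_)
open import Function.Construct.Identity using (⤖-id)
open import Function.Properties.Bijection using (⤖⇒↔)
open import Function.Properties.Inverse using (↔⇒⤖; ↔-sym)
open import Induction.WellFounded using (WellFounded; module Subrelation)
open import Relation.Binary using (Rel)
open import Relation.Binary.Construct.Closure.ReflexiveTransitive as Star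
  using (Star; ε; _◅_; _◅◅_)
open import Relation.Binary.Construct.Closure.Symmetric using (SymClosure; fwd; bwd; symmetric)
import Relation.Binary.Construct.On as On
open import Relation.Binary.PropositionalEquality
  using (_≡_; _≢_; refl; sym; trans; cong; subst; subst₂)
open import Relation.Nullary using (¬_; Dec; yes; no; does; contradiction)
open import Relation.Nullary.Decidable using (dec-true; _×-dec_; _⊎-dec_; _→-dec_; ¬?)
open import Relation.Unary using (Pred; Decidable)
open import Defs

open Equivalence using (to; from)

-- Call a vertex removable if it satisfies the two elimination conditions as the last vertex.
-- C2 and C3 hold in an eliminable graph because neither a violation of C2 nor a mountain or a
-- hill has a vertex that can come last.  Conversely both conditions and chordality are
-- inherited by induced subgraphs, so it is enough to find one removable vertex.
--
-- Let σ and τ be opposite signs.  By C2 the σ-neighbourhoods of the two ends of a τ-edge are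
-- nested.  Let s be a σ-plateau: no walk along τ-edges through vertices whose σ-neighbourhood
-- contains the one of s reaches a strictly larger σ-neighbourhood.  Let S be the set of
-- vertices on such walks.  An induced path through S between two non-adjacent boundary
-- vertices would yield a mountain or a hill, so the boundary of S is a clique, and Dirac's
-- theorem gives a vertex t of S whose τ-neighbours form a clique.  If t has a τ-neighbour
-- with at least the same σ-neighbours as s, then t is removable; otherwise t = s, so the
-- τ-neighbours of s form a clique.  Among the σ-plateaus, one with a maximal τ-neighbourhood is
-- a τ-plateau as well, and is then removable.

-- Finite subsets and connectivity

module _ {n : ℕ} {P : Pred (Fin n) 0ℓ} (P? : Decidable P) where

  comprehension : Subset n
  comprehension = tabulate (does ∘ P?)

  ∈-comprehension⁺ : ∀ {x} → P x → x ∈ comprehension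
  ∈-comprehension⁺ {x} Px = lookup⇒[]= x _ (trans (lookup∘tabulate _ x) (dec-true (P? x) Px))

  ∈-comprehension⁻ : ∀ {x} → x ∈ comprehension → P x
  ∈-comprehension⁻ {x} x∈ with P? x | trans (sym (lookup∘tabulate (does ∘ P?) x)) ([]=⇒lookup x∈)
  ... | yes Px | _ = Px
  ... | no _   | ()

module _ {n : ℕ} where

  ⊂-∪⁅⁆ : ∀ {A : Subset n} {u} → u ∉ A → A ⊂ A ∪ ⁅ u ⁆
  ⊂-∪⁅⁆ {A} {u} u∉A = p⊆p∪q _ , u , q⊆p∪q A _ (x∈⁅x⁆ u) , u∉A

  ∈-∪⁅⁆⁻ : ∀ {A : Subset n} {u x} → x ∈ A ∪ ⁅ u ⁆ → x ∈ A ⊎ x ≡ u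
  ∈-∪⁅⁆⁻ {A} {u} x∈ with x∈p∪q⁻ A ⁅ u ⁆ x∈
  ... | inj₁ x∈A = inj₁ x∈A
  ... | inj₂ x∈u = inj₂ (x∈⁅y⁆⇒x≡y u x∈u)

  Within : Rel (Fin n) 0ℓ → Subset n → Rel (Fin n) 0ℓ
  Within R A u v = R u v × u ∈ A × v ∈ A

  -- Rooted at `a` because the relation need not be symmetric: both `Adj` and the directed relation
  -- `Climb` are used.
  Connected : Rel (Fin n) 0ℓ → Fin n → Subset n → Set
  Connected R a A = a ∈ A × (∀ {v} → v ∈ A → Star (Within R A) a v)

  connected-⁅⁆ : ∀ {R : Rel (Fin n) 0ℓ} a → Connected R a ⁅ a ⁆
  connected-⁅⁆ {R} a = x∈⁅x⁆ a , λ v∈ → subst (Star _ a) (sym (x∈⁅y⁆⇒x≡y a v∈)) ε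

  connected-∪⁅⁆ : ∀ {R : Rel (Fin n) 0ℓ} {a A u v} → Connected R a A → v ∈ A → R v u →
                  Connected R a (A ∪ ⁅ u ⁆)
  connected-∪⁅⁆ {R} {a} {A} {u} {v} (a∈A , walk) v∈A Rvu = ⊆∪ a∈A , walk′ ∘ ∈-∪⁅⁆⁻
    where
    ⊆∪ : A ⊆ A ∪ ⁅ u ⁆
    ⊆∪ = p⊆p∪q ⁅ u ⁆
    widen : ∀ {x y} → Star (Within R A) x y → Star (Within R (A ∪ ⁅ u ⁆)) x y
    widen = Star.map λ (r , x∈ , y∈) → r , ⊆∪ x∈ , ⊆∪ y∈
    walk′ : ∀ {x} → x ∈ A ⊎ x ≡ u → Star (Within R (A ∪ ⁅ u ⁆)) a x
    walk′ (inj₁ x∈A)  = widen (walk x∈A)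
    walk′ (inj₂ refl) =
      widen (walk v∈A) ◅◅ (Rvu , ⊆∪ v∈A , q⊆p∪q A _ (x∈⁅x⁆ u)) ◅ ε

  -- Stated negatively: the existence of a removable vertex is decidable, so the whole search
  -- may run by contradiction, and no reachability relation has to be decided.
  component : ∀ (R : Rel (Fin n) 0ℓ) a →
    ¬ (∀ A → Connected R a A → ¬ (∀ {u v} → v ∈ A → R v u → u ∈ A))
  component R a none = grow ⁅ a ⁆ (⊃-wellFounded _) (connected-⁅⁆ a)
    where
    grow : ∀ A → Acc _⊃_ A → ¬ Connected R a A
    grow A (acc rec) conn = none A conn closed
      where
      closed : ∀ {u v} → v ∈ A → R v u → u ∈ A
      closed {u} v∈A Rvu with u ∈? A
      ... | yes u∈A = u∈A
      ... | no  u∉A = ⊥-elim (grow _ (rec (⊂-∪⁅⁆ u∉A)) (connected-∪⁅⁆ conn v∈A Rvu))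

-- Induced paths and simplicial vertices

neither : ∀ {A B : Set} → ¬ A → ¬ B → A ⇔ B
neither ¬a ¬b = mk⇔ (⊥-elim ∘ ¬a) (⊥-elim ∘ ¬b)

Consecutive : ∀ {k} → Rel (Fin k) 0ℓ
Consecutive = SymClosure λ i j → toℕ j ≡ suc (toℕ i)

consecutive-suc : ∀ {k} {i j : Fin k} → Consecutive i j → Consecutive (suc i) (suc j)
consecutive-suc (fwd e) = fwd (cong suc e)
consecutive-suc (bwd e) = bwd (cong suc e)

consecutive-pred : ∀ {k} {i j : Fin k} → Consecutive (suc i) (suc j) → Consecutive i j
consecutive-pred (fwd e) = fwd (ℕ.suc-injective e)
consecutive-pred (bwd e) = bwd (ℕ.suc-injective e)

module _ {n : ℕ} (H : Graph n) where
  open Graph H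

  -- Chords are excluded by the equivalence in `adjacent`. The last vertex is exempt from `A`, so
  -- that a path through a set can end outside it.
  record Path (A : Pred (Fin n) 0ℓ) (x y : Fin n) (k : ℕ) (p : Fin (suc k) → Fin n) : Set where
    field
      injective : Injective _≡_ _≡_ p
      adjacent  : ∀ i j → Adj (p i) (p j) ⇔ Consecutive i j
      start     : p zero ≡ x
      end       : p (fromℕ k) ≡ y
      inner     : ∀ i → toℕ i < k → A (p i)

  open Path

  trivialPath : ∀ {A} y → Path A y y 0 (λ _ → y)
  trivialPath y = record
    { injective = λ { {zero} {zero} _ → refl }
    ; adjacent  = λ { zero zero → neither (Adj-irrefl refl) λ { (fwd ()) ; (bwd ()) } }
    ; start = refl ; end = refl ; inner = λ _ () }

  tail : ∀ {A x y k p} → Path A x y (suc k) p → Path A (p (suc zero)) y k (p ∘ suc)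
  tail P = record
    { injective = suc-injective ∘ injective P
    ; adjacent  = λ i j → mk⇔ (consecutive-pred ∘ to (adjacent P (suc i) (suc j)))
                              (from (adjacent P (suc i) (suc j)) ∘ consecutive-suc)
    ; start = refl ; end = end P ; inner = λ i i<k → inner P (suc i) (s≤s i<k) }

  extend : ∀ {A x z y k p} → A x → Path A z y k p → Adj x (p zero) →
           (∀ i → ¬ Adj x (p (suc i))) → (∀ i → x ≢ p i) → Path A x y (suc k) (x ∷ᶠ p)
  extend {A} {x} {z} {y} {k} {p} Ax P x~p₀ x≁p x∉p = record
    { injective = inj ; adjacent = adj ; start = refl ; end = end P ; inner = inn }
    where
    q = x ∷ᶠ p
    inj : Injective _≡_ _≡_ q
    inj {zero}  {zero}  _ = refl
    inj {zero}  {suc j} e = contradiction e (x∉p j)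
    inj {suc i} {zero}  e = contradiction (sym e) (x∉p i)
    inj {suc i} {suc j} e = cong suc (injective P e)
    adj₀ : ∀ j → Adj x (p j) ⇔ Consecutive zero (suc j)
    adj₀ zero    = mk⇔ (λ _ → fwd refl) (λ _ → x~p₀)
    adj₀ (suc j) = neither (x≁p j) λ { (fwd ()) ; (bwd ()) }
    adj : ∀ i j → Adj (q i) (q j) ⇔ Consecutive i j
    adj zero    zero    = neither (Adj-irrefl refl) λ { (fwd ()) ; (bwd ()) }
    adj zero    (suc j) = adj₀ j
    adj (suc i) zero    = mk⇔ (symmetric _ ∘ to (adj₀ i) ∘ Adj-sym)
                              (Adj-sym ∘ from (adj₀ i) ∘ symmetric _)
    adj (suc i) (suc j) = mk⇔ (consecutive-suc ∘ to (adjacent P i j))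
                              (from (adjacent P i j) ∘ consecutive-pred)
    inn : ∀ i → toℕ i < suc k → A (q i)
    inn zero    _         = Ax
    inn (suc i) (s≤s i<k) = inner P i i<k

  -- Shortcutting at the last vertex of the path that x meets keeps the path induced.
  prepend : ∀ {A x z y} k {p} → A x → x ≢ y → Path A z y k p →
            ∃ (λ i → Adj x (p i) ⊎ x ≡ p i) → ∃₂ (Path A x y)
  prepend {x = x} k {p} Ax x≢y P meets with any? (λ i → Adj? x (p (suc i)) ⊎-dec (x ≟ p (suc i)))
  prepend (suc k) Ax x≢y P _ | yes meets = prepend k Ax x≢y (tail P) meets
  prepend k Ax x≢y P (suc i , m) | no none = contradiction (i , m) none
  prepend zero {p} Ax x≢y P (zero , inj₂ x≡p₀) | no none = contradiction (trans x≡p₀ (end P)) x≢y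
  prepend (suc k) {p} Ax x≢y P (zero , inj₂ x≡p₀) | no none = suc k , p , record
    { injective = injective P ; adjacent = adjacent P
    ; start = sym x≡p₀ ; end = end P ; inner = inner P }
  prepend {x = x} k {p} Ax x≢y P (zero , inj₁ x~p₀) | no none =
    suc k , x ∷ᶠ p , extend Ax P x~p₀ (λ i a → none (i , inj₁ a)) x∉p
    where
    x∉p : ∀ i → x ≢ p i
    x∉p zero    e = Adj-irrefl e x~p₀
    x∉p (suc i) e = none (i , inj₂ e)

  -- Starting from the trivial path at `y`, the vertices of the walk are prepended from its far end
  -- backwards. As `y` lies outside `A`, none of them is `y`, which `prepend` requires.
  walk⇒path : ∀ {A : Pred (Fin n) 0ℓ} {u v y} → ¬ A y → Star (λ a b → Adj a b × A a) u v →
              A v → Adj v y → ∃₂ (Path A u y)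
  walk⇒path {A} {y = y} y∉A ε v∈A v~y =
    prepend 0 v∈A (λ { refl → y∉A v∈A }) (trivialPath y) (zero , inj₁ v~y)
  walk⇒path {A} y∉A ((u~w , u∈A) ◅ walk) v∈A v~y with walk⇒path y∉A walk v∈A v~y
  ... | k , p , P = prepend k u∈A (λ { refl → y∉A u∈A }) P
                      (zero , inj₁ (subst (Adj _) (sym (start P)) u~w))

  record Bridge (A : Subset n) (x y : Fin n) : Set where
    field
      {k}      : ℕ
      p        : Fin (suc k) → Fin n
      2≤k      : 2 ≤ k
      inj      : Injective _≡_ _≡_ p
      adj      : ∀ i j → Adj (p i) (p j) ⇔ Consecutive i j
      first    : ∀ {i} → toℕ i ≡ 0 → p i ≡ x
      last     : ∀ {i} → toℕ i ≡ k → p i ≡ y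
      interior : ∀ {i} → toℕ i ≢ 0 → toℕ i ≢ k → p i ∈ A

    data Place (i : Fin (suc k)) : Set where
      at-start : toℕ i ≡ 0 → Place i
      at-end   : toℕ i ≡ k → Place i
      between  : toℕ i ≢ 0 → toℕ i ≢ k → Place i

    place : ∀ i → Place i
    place i with toℕ i ℕ.≟ 0 | toℕ i ℕ.≟ k
    ... | yes i≡0 | _       = at-start i≡0
    ... | no  _   | yes i≡k = at-end i≡k
    ... | no  i≢0 | no  i≢k = between i≢0 i≢k

  -- The attachment points `z` and `z′` are joined inside `A` by a walk through the root `a`; the
  -- resulting walk from `x` to `y` is then shortened to an induced path.
  bridge : ∀ {A a x y z z′} → Connected Adj a A → x ∉ A → y ∉ A → x ≢ y → ¬ Adj x y →
           z ∈ A → Adj x z → z′ ∈ A → Adj y z′ → Bridge A x y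
  bridge {A} {a} {x} {y} {z} {z′} (_ , walk) x∉A y∉A x≢y x≁y z∈A x~z z′∈A y~z′ = record
    { p = p ; 2≤k = 2≤k k p P ; inj = injective P ; adj = adjacent P
    ; first = λ e → trans (cong p (toℕ-injective e)) (start P)
    ; last  = λ e → trans (cong p (toℕ-injective (trans e (sym (toℕ-fromℕ k))))) (end P)
    ; interior = λ {i} i≢0 i≢k → in-A (inner P i (ℕ.≤∧≢⇒< (toℕ≤pred[n] i) i≢k)) i≢0 }
    where
    -- `Path` wants its start in the set too, so `x` is adjoined; by injectivity only index 0 can be
    -- `x`, and `in-A` removes it again.
    A⁺ : Pred (Fin n) 0ℓ
    A⁺ v = v ∈ A ⊎ v ≡ x
    y∉A⁺ : ¬ A⁺ y
    y∉A⁺ (inj₁ y∈A) = y∉A y∈A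
    y∉A⁺ (inj₂ y≡x) = x≢y (sym y≡x)
    backwards : Star (Within Adj A) z a
    backwards = Star.reverse (λ (r , u∈ , v∈) → Adj-sym r , v∈ , u∈) (walk z∈A)
    full : Star (λ a b → Adj a b × A⁺ a) x z′
    full = (x~z , inj₂ refl) ◅ Star.map (λ (r , u∈ , _) → r , inj₁ u∈) (backwards ◅◅ walk z′∈A)
    found : ∃₂ (Path A⁺ x y)
    found = walk⇒path y∉A⁺ full (inj₁ z′∈A) (Adj-sym y~z′)
    k = proj₁ found
    p = proj₁ (proj₂ found)
    P = proj₂ (proj₂ found)
    2≤k : ∀ k p → Path A⁺ x y k p → 2 ≤ k
    2≤k zero          p P = contradiction (trans (sym (start P)) (end P)) x≢y
    2≤k (suc zero)    p P = contradiction
      (subst₂ Adj (start P) (end P) (from (adjacent P zero (suc zero)) (fwd refl))) x≁y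
    2≤k (suc (suc k)) p P = s≤s (s≤s z≤n)
    in-A : ∀ {i} → A⁺ (p i) → toℕ i ≢ 0 → p i ∈ A
    in-A     (inj₁ ∈A) _   = ∈A
    in-A {i} (inj₂ ≡x) i≢0 = contradiction (cong toℕ (injective P (trans ≡x (sym (start P))))) i≢0

  -- `c` sees exactly the two ends of the bridge, so it closes the path to an induced cycle. The
  -- path has `suc k` vertices with `2 ≤ k`, hence the cycle has at least four.
  no-long-cycle : Chordal H → ∀ {A x y c} → Bridge A x y → Adj c x → Adj c y →
                  c ∉ A → ¬ (∀ {v} → v ∈ A → ¬ Adj v c)
  no-long-cycle chordal {A} {x} {y} {c} B c~x c~y c∉A c≁A =
    chordal (suc (suc k)) (s≤s (s≤s 2≤k)) (mk↣ q-inj) (⤖-id _ , cycle)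
    where
    open Bridge B
    q = c ∷ᶠ p
    c∉p : ∀ i → c ≢ p i
    c∉p i c≡pᵢ with place i
    ... | at-start e = Adj-irrefl (trans c≡pᵢ (first e)) c~x
    ... | at-end e   = Adj-irrefl (trans c≡pᵢ (last e)) c~y
    ... | between i≢0 i≢k = c∉A (subst (_∈ A) (sym c≡pᵢ) (interior i≢0 i≢k))
    q-inj : Injective _≡_ _≡_ q
    q-inj {zero}  {zero}  _ = refl
    q-inj {zero}  {suc j} e = contradiction e (c∉p j)
    q-inj {suc i} {zero}  e = contradiction (sym e) (c∉p i)
    q-inj {suc i} {suc j} e = cong suc (inj e)
    hub⁺ : ∀ j → Adj c (p j) → SymClosure CycleStep zero (suc j)
    hub⁺ j c~pⱼ with place j
    ... | at-start e = fwd (next (cong suc e))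
    ... | at-end e   = bwd (close (cong suc (cong suc e)) refl)
    ... | between j≢0 j≢k = contradiction (Adj-sym c~pⱼ) (c≁A (interior j≢0 j≢k))
    hub⁻ : ∀ j → SymClosure CycleStep zero (suc j) → Adj c (p j)
    hub⁻ j (fwd (next e))    = subst (Adj c) (sym (first (ℕ.suc-injective e))) c~x
    hub⁻ j (bwd (close e _)) = subst (Adj c) (sym (last (ℕ.suc-injective (ℕ.suc-injective e)))) c~y
    up : ∀ {i j} → Consecutive i j → SymClosure CycleStep (suc i) (suc j)
    up (fwd e) = fwd (next (cong suc e))
    up (bwd e) = bwd (next (cong suc e))
    down : ∀ {i j} → SymClosure CycleStep (suc i) (suc j) → Consecutive i j
    down (fwd (next e)) = fwd (ℕ.suc-injective e)
    down (bwd (next e)) = bwd (ℕ.suc-injective e)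
    cycle : ∀ i j → Adj (q i) (q j) ⇔ SymClosure CycleStep i j
    cycle zero    zero    = neither (Adj-irrefl refl)
      λ { (fwd (next ())) ; (fwd (close () _)) ; (bwd (next ())) ; (bwd (close () _)) }
    cycle zero    (suc j) = mk⇔ (hub⁺ j) (hub⁻ j)
    cycle (suc i) zero    = mk⇔ (symmetric _ ∘ hub⁺ i ∘ Adj-sym) (Adj-sym ∘ hub⁻ i ∘ symmetric _)
    cycle (suc i) (suc j) = mk⇔ (up ∘ to (adj i j)) (from (adj i j) ∘ down)

  Clique : Pred (Fin n) 0ℓ → Set
  Clique K = ∀ {u v} → K u → K v → u ≢ v → Adj u v

  SimplicialIn : Subset n → Fin n → Set
  SimplicialIn W b = b ∈ W × Clique (λ u → u ∈ W × Adj b u)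

  -- Dirac's argument: for a maximal connected A ∋ a that does not dominate W, every
  -- neighbour of A is adjacent to the whole undominated part B, so the neighbours of A
  -- form a clique and a simplicial vertex of B is simplicial in W.
  dirac : Chordal H → ∀ {W a c} → a ∈ W → c ∈ W → a ≢ c → ¬ Adj a c →
          ¬ (∀ b → a ≢ b → ¬ Adj a b → ¬ SimplicialIn W b)
  dirac chordal {W} = go W (⊂-wellFounded W)
    where
    go : ∀ W → Acc _⊂_ W → ∀ {a c} → a ∈ W → c ∈ W → a ≢ c → ¬ Adj a c →
         ¬ (∀ b → a ≢ b → ¬ Adj a b → ¬ SimplicialIn W b)
    go W (acc smaller) {a} a∈W c∈W a≢c a≁c none =
      grow ⁅ a ⁆ (⊃-wellFounded _) (connected-⁅⁆ a)
        (λ x∈ → subst (_∈ W) (sym (x∈⁅y⁆⇒x≡y a x∈)) a∈W)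
        (_ , c∈W , (λ c∈ → a≢c (sym (x∈⁅y⁆⇒x≡y a c∈)))
           , λ x∈ x~c → a≁c (subst (λ x → Adj x _) (x∈⁅y⁆⇒x≡y a x∈) x~c))
      where
      Undominated : Subset n → Fin n → Set
      Undominated A c = c ∈ W × c ∉ A × (∀ {x} → x ∈ A → ¬ Adj x c)

      grow : ∀ A → Acc _⊃_ A → Connected Adj a A → A ⊆ W → ¬ ∃ (Undominated A)
      grow A (acc larger) conn@(a∈A , _) A⊆W (c , c∈) =
        none c (λ { refl → proj₁ (proj₂ c∈) a∈A }) (proj₂ (proj₂ c∈) a∈A) (simplicial c-simplicial)
        where
        undominated? : Decidable (Undominated A)
        undominated? c with c ∈? W | c ∈? A | any? (λ x → (x ∈? A) ×-dec Adj? x c)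
        ... | no c∉W  | _       | _               = no (c∉W ∘ proj₁)
        ... | yes _   | yes c∈A | _               = no λ (_ , c∉A , _) → c∉A c∈A
        ... | yes _   | no _    | yes (_ , x∈ , r) = no λ (_ , _ , u) → u x∈ r
        ... | yes c∈W | no c∉A  | no ¬dom         = yes (c∈W , c∉A , λ x∈ r → ¬dom (_ , x∈ , r))

        B : Subset n
        B = comprehension undominated?

        B⁻ : ∀ {c} → c ∈ B → Undominated A c
        B⁻ = ∈-comprehension⁻ undominated?

        B⊂W : B ⊂ W
        B⊂W = proj₁ ∘ B⁻ , a , a∈W , λ a∈B → proj₁ (proj₂ (B⁻ a∈B)) a∈A

        Neighbour : Pred (Fin n) 0ℓ
        Neighbour x = x ∈ W × x ∉ A × ∃ λ z → z ∈ A × Adj x z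

        neighbour-complete : ∀ {x c} → Neighbour x → Undominated A c → Adj x c
        neighbour-complete {x} {c} (x∈W , x∉A , z , z∈A , x~z) (c∈W , c∉A , c≁A) with Adj? x c
        ... | yes x~c = x~c
        -- Otherwise `A ∪ ⁅ x ⁆` is a larger connected set that still does not dominate `c`.
        ... | no  x≁c = ⊥-elim (grow _ (larger (⊂-∪⁅⁆ x∉A)) (connected-∪⁅⁆ conn z∈A (Adj-sym x~z))
              ([ A⊆W , (λ { refl → x∈W }) ]′ ∘ ∈-∪⁅⁆⁻)
              (c , c∈W
                 , [ c∉A , (λ { refl → c≁A z∈A (Adj-sym x~z) }) ]′ ∘ ∈-∪⁅⁆⁻
                 , [ c≁A , (λ { refl → x≁c }) ]′ ∘ ∈-∪⁅⁆⁻))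

        neighbours-clique : Clique Neighbour
        neighbours-clique {x} {y} Nx@(_ , x∉A , _ , z∈A , x~z) Ny@(_ , y∉A , _ , z′∈A , y~z′) x≢y
          with Adj? x y
        ... | yes x~y = x~y
        ... | no  x≁y = ⊥-elim (no-long-cycle chordal
              (bridge conn x∉A y∉A x≢y x≁y z∈A x~z z′∈A y~z′)
              (Adj-sym (neighbour-complete Nx c∈)) (Adj-sym (neighbour-complete Ny c∈))
              (proj₁ (proj₂ c∈)) (proj₂ (proj₂ c∈)))

        classify : ∀ {b u} → Undominated A b → u ∈ W → Adj b u → Undominated A u ⊎ Neighbour u
        classify {b} {u} (_ , _ , b≁A) u∈W b~u
          with undominated? u | any? (λ x → (x ∈? A) ×-dec Adj? u x)
        ... | yes U | _ = inj₁ U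
        ... | no _  | yes (z , z∈A , u~z) =
              inj₂ (u∈W , (λ u∈A → b≁A u∈A (Adj-sym b~u)) , z , z∈A , u~z)
        ... | no ¬U | no ¬dom = contradiction
              (u∈W , (λ u∈A → b≁A u∈A (Adj-sym b~u)) , λ {x} x∈ r → ¬dom (x , x∈ , Adj-sym r)) ¬U

        simplicial : ∀ {b} → SimplicialIn B b → SimplicialIn W b
        simplicial {b} (b∈B , clique) = proj₁ Ub , λ (u∈W , b~u) (v∈W , b~v) u≢v →
          adjoin b~u b~v u≢v (classify Ub u∈W b~u) (classify Ub v∈W b~v)
          where
          Ub = B⁻ b∈B
          adjoin : ∀ {u v} → Adj b u → Adj b v → u ≢ v →
                 Undominated A u ⊎ Neighbour u → Undominated A v ⊎ Neighbour v → Adj u v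
          adjoin b~u b~v u≢v (inj₁ Uu) (inj₁ Uv) =
            clique (∈-comprehension⁺ undominated? Uu , b~u)
                   (∈-comprehension⁺ undominated? Uv , b~v) u≢v
          adjoin b~u b~v u≢v (inj₁ Uu) (inj₂ Nv) = Adj-sym (neighbour-complete Nv Uu)
          adjoin b~u b~v u≢v (inj₂ Nu) (inj₁ Uv) = neighbour-complete Nu Uv
          adjoin b~u b~v u≢v (inj₂ Nu) (inj₂ Nv) = neighbours-clique Nu Nv u≢v

        none-in-B : ∀ b → ¬ SimplicialIn B b
        none-in-B b S@(b∈B , _) = none b (λ { refl → proj₁ (proj₂ (B⁻ b∈B)) a∈A })
          (proj₂ (proj₂ (B⁻ b∈B)) a∈A) (simplicial S)

        c-simplicial : SimplicialIn B c
        c-simplicial = ∈-comprehension⁺ undominated? c∈ , clique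
          where
          clique : Clique (λ u → u ∈ B × Adj c u)
          clique {u} {v} (u∈B , _) (v∈B , _) u≢v with Adj? u v
          ... | yes u~v = u~v
          -- Induction on `B`, a proper subset of `W`, would give a simplicial vertex of `B`, which
          -- `none-in-B` excludes.
          ... | no  u≁v = ⊥-elim (go B (smaller B⊂W) u∈B v∈B u≢v u≁v λ b _ _ → none-in-B b)

  -- Unless `t` is itself simplicial in `W`, two applications of `dirac` produce two non-adjacent
  -- simplicial vertices, and a clique contains at most one of them.
  simplicial-outside-clique : Chordal H → ∀ {W K t} → Clique (_∈ K) → t ∈ W → t ∉ K →
                              ¬ (∀ b → b ∉ K → ¬ SimplicialIn W b)
  simplicial-outside-clique chordal {W} {K} {t} K-clique t∈W t∉K none = none t t∉K (t∈W , clique)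
    where
    clique : Clique (λ u → u ∈ W × Adj t u)
    clique {u} {v} (u∈W , _) (v∈W , _) u≢v with Adj? u v
    ... | yes u~v = u~v
    ... | no  u≁v = ⊥-elim (dirac chordal u∈W v∈W u≢v u≁v first)
      where
      first : ∀ b → u ≢ b → ¬ Adj u b → ¬ SimplicialIn W b
      first b u≢b u≁b simp@(b∈W , _) = dirac chordal b∈W u∈W (u≢b ∘ sym) (u≁b ∘ Adj-sym) second
        where
        second : ∀ b′ → b ≢ b′ → ¬ Adj b b′ → ¬ SimplicialIn W b′
        second b′ b≢b′ b≁b′ simp′ with b ∈? K | b′ ∈? K
        ... | no b∉K  | _        = none b b∉K simp
        ... | yes _   | no b′∉K  = none b′ b′∉K simp′
        ... | yes b∈K | yes b′∈K = b≁b′ (K-clique b∈K b′∈K b≢b′)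

consecutive⇒path : ∀ {k m} {i j : Fin k} →
                   Consecutive i j → SymClosure (PathEdge {k} {m}) (inj₁ i) (inj₁ j)
consecutive⇒path (fwd e) = fwd (step e)
consecutive⇒path (bwd e) = bwd (step e)

path⇒consecutive : ∀ {k m} {i j : Fin k} →
                   SymClosure (PathEdge {k} {m}) (inj₁ i) (inj₁ j) → Consecutive i j
path⇒consecutive (fwd (step e)) = fwd e
path⇒consecutive (bwd (step e)) = bwd e

star-invariant : ∀ {A : Set} {R : Rel A 0ℓ} (I : Pred A 0ℓ) → (∀ {x y} → R x y → I x → I y) →
                 ∀ {x y} → Star R x y → I x → I y
star-invariant I pres ε        Ix = Ix
star-invariant I pres (r ◅ rs) Ix = star-invariant I pres rs (pres r Ix)

-- Neighbourhoods by sign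

module Signs {n : ℕ} (G : SignedGraph n) where
  open SignedGraph G public

  E⇒Adj : ∀ σ {u v} → E σ u v → Adj u v
  E⇒Adj ⊕ e = from (cover _ _) (inj₁ e)
  E⇒Adj ⊖ e = from (cover _ _) (inj₂ e)

  E-irrefl : ∀ σ {u} → ¬ E σ u u
  E-irrefl σ e = Adj-irrefl refl (E⇒Adj σ e)

  E-opposite : ∀ {σ τ u v} → opposite σ ≡ τ → E σ u v → ¬ E τ u v
  E-opposite {⊕} refl e e′ = disjoint _ _ (e , e′)
  E-opposite {⊖} refl e e′ = disjoint _ _ (e′ , e)

  Adj⇒E : ∀ {σ τ u v} → opposite σ ≡ τ → Adj u v → E σ u v ⊎ E τ u v
  Adj⇒E {⊕} refl a = to (cover _ _) a
  Adj⇒E {⊖} refl a with to (cover _ _) a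
  ... | inj₁ e = inj₂ e
  ... | inj₂ e = inj₁ e

  infix 4 _⊑[_]_ _⊏[_]_

  _⊑[_]_ : Fin n → Sign → Fin n → Set
  x ⊑[ σ ] y = ∀ z → E σ x z → E σ y z

  _⊑[_]?_ : ∀ x σ y → Dec (x ⊑[ σ ] y)
  x ⊑[ σ ]? y = all? λ z → E? σ x z →-dec E? σ y z

  ⊑-refl : ∀ {σ x} → x ⊑[ σ ] x
  ⊑-refl z e = e

  ⊑-trans : ∀ {σ x y z} → x ⊑[ σ ] y → y ⊑[ σ ] z → x ⊑[ σ ] z
  ⊑-trans p q w e = q w (p w e)

  ⋢-witness : ∀ {σ x y} → ¬ x ⊑[ σ ] y → ∃ λ z → E σ x z × ¬ E σ y z
  ⋢-witness {σ} {x} {y} x⋢y with any? (λ z → E? σ x z ×-dec ¬? (E? σ y z))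
  ... | yes w = w
  ... | no ¬w = contradiction sub x⋢y
    where
    sub : x ⊑[ σ ] y
    sub z e with E? σ y z
    ... | yes e′ = e′
    ... | no ¬e  = contradiction (z , e , ¬e) ¬w

  _⊏[_]_ : Fin n → Sign → Fin n → Set
  x ⊏[ σ ] y = x ⊑[ σ ] y × ¬ y ⊑[ σ ] x

  ⊐-wellFounded : ∀ σ → WellFounded (λ y x → x ⊏[ σ ] y)
  ⊐-wellFounded σ = Subrelation.wellFounded ⊏⇒⊂ (On.wellFounded N ⊃-wellFounded)
    where
    N : Fin n → Subset n
    N x = comprehension (E? σ x)
    ⊏⇒⊂ : ∀ {y x} → x ⊏[ σ ] y → N x ⊂ N y
    ⊏⇒⊂ {y} {x} (x⊑y , y⋢x) with ⋢-witness y⋢x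
    ... | z , e , ¬e = ∈-comprehension⁺ (E? σ y) ∘ x⊑y _ ∘ ∈-comprehension⁻ (E? σ x)
                     , z , ∈-comprehension⁺ (E? σ y) e , ¬e ∘ ∈-comprehension⁻ (E? σ x)

  -- The two SEO conditions at a vertex w that comes last, sorted by the sign of an edge at w.
  Good : Sign → Sign → Fin n → Set
  Good σ τ w = (∀ u v → u ≢ v → E σ w u → E σ w v → E σ u v)
             × (∀ v → E σ w v → v ⊑[ τ ] w)

  Removable : Fin n → Set
  Removable w = ∀ {σ τ} → opposite σ ≡ τ → Good σ τ w

  good? : ∀ σ τ → Decidable (Good σ τ)
  good? σ τ w =
    all? (λ u → all? λ v → ¬? (u ≟ v) →-dec (E? σ w u →-dec (E? σ w v →-dec E? σ u v)))
    ×-dec all? (λ v → E? σ w v →-dec (v ⊑[ τ ]? w))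

  good⇒removable : ∀ {σ τ w} → opposite σ ≡ τ → Good σ τ w → Good τ σ w → Removable w
  good⇒removable {⊕} refl g h {⊕} refl = g
  good⇒removable {⊕} refl g h {⊖} refl = h
  good⇒removable {⊖} refl g h {⊕} refl = h
  good⇒removable {⊖} refl g h {⊖} refl = g

  removable? : Decidable Removable
  removable? w with good? ⊕ ⊖ w | good? ⊖ ⊕ w
  ... | yes p | yes m = yes (good⇒removable refl p m)
  ... | no ¬p | _     = no λ r → ¬p (r refl)
  ... | _     | no ¬m = no λ r → ¬m (r refl)

  module _ {m k : ℕ} (q : Fin m ⊎ Fin k → Fin n) (q-inj : Injective _≡_ _≡_ q) where

    enumeration : Fin (m ℕ.+ k) ↣ Fin n
    enumeration = mk↣ {to = q ∘ splitAt m} λ {x} {y} e →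
      trans (sym (join-splitAt m k x)) (trans (cong (join m k) (q-inj e)) (join-splitAt m k y))

    relabel : ∀ {σ} {S : Rel (Fin m ⊎ Fin k) 0ℓ} → (∀ x y → E σ (q x) (q y) ⇔ S x y) →
              ∀ x y → E σ (q (splitAt m (join m k x))) (q (splitAt m (join m k y))) ⇔ S x y
    relabel h x y rewrite splitAt-join m k x | splitAt-join m k y = h x y

  mountain⇒¬C3 : ∀ {σ m} → 3 ≤ m → (q : Fin m ⊎ Fin 1 → Fin n) → Injective _≡_ _≡_ q →
                 (∀ x y → E (opposite σ) (q x) (q y) ⇔ SymClosure PathEdge x y) →
                 (∀ x y → E σ (q x) (q y) ⇔ SymClosure MountainEdge x y) → ¬ C3 G
  mountain⇒¬C3 {σ} {m} 3≤m q q-inj paths spokes c3 = proj₁ (c3 _ (enumeration q q-inj))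
    (σ , m , 3≤m , ↔⇒⤖ (↔-sym +↔⊎) , relabel q q-inj paths , relabel q q-inj spokes)

  hill⇒¬C3 : ∀ {σ m} → 2 ≤ m → (q : Fin m ⊎ Fin 2 → Fin n) → Injective _≡_ _≡_ q →
             (∀ x y → E (opposite σ) (q x) (q y) ⇔ SymClosure PathEdge x y) →
             (∀ x y → E σ (q x) (q y) ⇔ SymClosure HillEdge x y) → ¬ C3 G
  hill⇒¬C3 {σ} {m} 2≤m q q-inj paths spokes c3 = proj₂ (c3 _ (enumeration q q-inj))
    (σ , m , 2≤m , ↔⇒⤖ (↔-sym +↔⊎) , relabel q q-inj paths , relabel q q-inj spokes)

-- Plateaus

module _ {n : ℕ} (G : SignedGraph n) (c2 : C2 G) where
  open Signs G

  module Alternating {σ τ} (opp : opposite σ ≡ τ) where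

    -- Of the six distinctness conditions in `C2`, three hold because edges are not loops, and
    -- `a ≡ w` or `v ≡ b` would give one edge both signs; only `a ≢ b` remains.
    alternating : ∀ {a v w b} → a ≢ b → E σ a v → E τ v w → E σ w b →
                  (E σ a w × E σ a b) ⊎ (E σ a b × E σ v b)
    alternating {a} {v} {w} {b} a≢b av vw wb with a ≟ w | v ≟ b
    ... | yes refl | _ = contradiction (E-sym τ vw) (E-opposite opp av)
    ... | no _ | yes refl = contradiction (E-sym τ vw) (E-opposite opp wb)
    ... | no a≢w | no v≢b = c2 σ a v w b
      (λ { refl → E-irrefl σ av }) a≢w a≢b (λ { refl → E-irrefl τ vw }) v≢b
      (λ { refl → E-irrefl σ wb }) av (subst (λ ρ → E ρ v w) (sym opp) vw) wb

    cross : ∀ {a v w b} → a ≢ b → E σ a v → E τ v w → E σ w b → E σ a b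
    cross a≢b av vw wb = [ proj₂ , proj₁ ]′ (alternating a≢b av vw wb)

    -- If `a` is a σ-neighbour of `v` but not of `w`, then `C2` applies to `a v w b` for every other
    -- σ-neighbour `b` of `w`. The alternative containing the edge `aw` is excluded, so `vb` has
    -- sign σ.
    nested : ∀ {v w} → E τ v w → v ⊑[ σ ] w ⊎ w ⊑[ σ ] v
    nested {v} {w} vw with v ⊑[ σ ]? w
    ... | yes v⊑w = inj₁ v⊑w
    ... | no  v⋢w with ⋢-witness v⋢w
    ...   | a , va , ¬wa = inj₂ sub
      where
      sub : w ⊑[ σ ] v
      sub b wb with a ≟ b
      ... | yes refl = va
      ... | no a≢b with alternating a≢b (E-sym σ va) vw wb
      ...   | inj₁ (aw , _) = contradiction (E-sym σ aw) ¬wa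
      ...   | inj₂ (_ , vb) = vb

    -- The bound is the fixed root `s`, not the source `x`: along a walk the σ-neighbourhoods may
    -- shrink, but never lose a σ-neighbour of `s`.
    Climb : Fin n → Rel (Fin n) 0ℓ
    Climb s x y = E τ x y × s ⊑[ σ ] y

    -- By `climb-above`, all vertices reached then share the σ-neighbourhood of `s`.
    Plateau : Fin n → Set
    Plateau s = ∀ {d} → Star (Climb s) s d → d ⊑[ σ ] s

    climb-above : ∀ {s d} → Star (Climb s) s d → s ⊑[ σ ] d
    climb-above {s} walk = star-invariant (λ d → s ⊑[ σ ] d) (λ r _ → proj₂ r) walk ⊑-refl

    plateau-neighbour : ∀ {s b} → Plateau s → E τ s b → b ⊑[ σ ] s
    plateau-neighbour P sb with nested sb
    ... | inj₂ b⊑s = b⊑s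
    ... | inj₁ s⊑b = P ((sb , s⊑b) ◅ ε)

-- The component of a plateau and its boundary

module _ {n : ℕ} (G : SignedGraph n) (chordal : Chordal (SignedGraph.graph G))
         (c2 : C2 G) (c3 : C3 G) where
  open Signs G

  module PlateauComponent {σ τ} (opp : opposite σ ≡ τ) {s} (plateau : Alternating.Plateau G c2 opp s)
    (S : Subset n) (connected : Connected (Alternating.Climb G c2 opp s) s S)
    (closed : ∀ {u v} → v ∈ S → Alternating.Climb G c2 opp s v u → u ∈ S) where

    open Alternating G c2 opp

    opp′ : opposite τ ≡ σ
    opp′ = opposite-selfInverse opp

    module τσ = Alternating G c2 opp′

    clash : ∀ {u v} → E σ u v → ¬ E τ u v
    clash = E-opposite opp

    climb : ∀ {t} → t ∈ S → Star (Climb s) s t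
    climb t∈S = Star.map proj₁ (proj₂ connected t∈S)

    S⊑s : ∀ {t} → t ∈ S → t ⊑[ σ ] s
    S⊑s t∈S = plateau (climb t∈S)

    s⊑S : ∀ {t} → t ∈ S → s ⊑[ σ ] t
    s⊑S t∈S = climb-above (climb t∈S)

    S-connected : Connected Adj s S
    S-connected = proj₁ connected ,
      λ v∈ → Star.map (λ ((e , _) , u∈ , v∈) → E⇒Adj τ e , u∈ , v∈) (proj₂ connected v∈)

    Boundary : Pred (Fin n) 0ℓ
    Boundary b = b ∉ S × ∃ λ t → t ∈ S × E τ b t

    boundary? : Decidable Boundary
    boundary? b = ¬? (b ∈? S) ×-dec any? λ t → (t ∈? S) ×-dec E? τ b t

    boundary⋢ : ∀ {b} → Boundary b → ¬ s ⊑[ σ ] b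
    boundary⋢ (b∉S , t , t∈S , bt) s⊑b = b∉S (closed t∈S (E-sym τ bt , s⊑b))

    -- Nestedness along the edge `bt` leaves only this case: containing the σ-neighbourhood of `t`
    -- would mean containing that of `s`, and `b` would belong to `S`.
    boundary⊑ : ∀ {b} → Boundary b → b ⊑[ σ ] s
    boundary⊑ B@(b∉S , t , t∈S , bt) with nested bt
    ... | inj₁ b⊑t = ⊑-trans b⊑t (S⊑s t∈S)
    ... | inj₂ t⊑b = contradiction (⊑-trans (s⊑S t∈S) t⊑b) (boundary⋢ B)

    Region : Pred (Fin n) 0ℓ
    Region x = x ∈ S ⊎ Boundary x

    region⊑ : ∀ {x} → Region x → x ⊑[ σ ] s
    region⊑ (inj₁ x∈S) = S⊑s x∈S
    region⊑ (inj₂ B)   = boundary⊑ B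

    -- A σ-neighbour of `s` is σ-adjacent to all of `S`. In `S` it would carry a loop; on the
    -- boundary its τ-edge into `S` would have both signs.
    region-off : ∀ {x} → Region x → ¬ E σ s x
    region-off (inj₁ x∈S)               sx = E-irrefl σ (s⊑S x∈S _ sx)
    region-off (inj₂ (_ , t , t∈S , bt)) sb = clash (s⊑S t∈S _ sb) (E-sym τ bt)

    region-no-σ : ∀ {x y} → Region x → Region y → ¬ E σ x y
    region-no-σ Rx Ry xy = region-off Ry (region⊑ Rx _ xy)

    region-τ : ∀ {x y} → Region x → Region y → Adj x y → E τ x y
    region-τ Rx Ry xy with Adj⇒E opp xy
    ... | inj₁ e = contradiction e (region-no-σ Rx Ry)
    ... | inj₂ e = e

    neighbour-region : ∀ {x t} → t ∈ S → E τ t x → Region x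
    neighbour-region {x} {t} t∈S tx with x ∈? S
    ... | yes x∈S = inj₁ x∈S
    ... | no  x∉S = inj₂ (x∉S , t , t∈S , E-sym τ tx)

    -- The σ-neighbour w of s is σ-adjacent to all of S, so along τ-edges inside S the
    -- τ-adjacency to b propagates by C2 and finally reaches z.
    spread : ∀ {w b z} → E σ s w → E τ w b → Boundary b → Boundary z → b ≢ z → E τ b z
    spread {w} {b} {z} sw wb (b∉S , t , t∈S , bt) (_ , t′ , t′∈S , zt′) b≢z =
      push t′∈S bt′ b≢z (E-sym τ zt′)
      where
      push : ∀ {x y} → x ∈ S → E τ b x → b ≢ y → E τ x y → E τ b y
      push x∈S bx b≢y xy = τσ.cross b≢y (E-sym τ wb) (E-sym σ (s⊑S x∈S _ sw)) xy
      walk : Star (Within (E τ) S) t t′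
      walk = Star.reverse (λ ((e , _) , u∈ , v∈) → E-sym τ e , v∈ , u∈) (proj₂ connected t∈S)
             ◅◅ Star.map (λ ((e , _) , u∈ , v∈) → e , u∈ , v∈) (proj₂ connected t′∈S)
      bt′ : E τ b t′
      bt′ = star-invariant (E τ b)
        (λ (e , x∈S , y∈S) bx → push x∈S bx (λ { refl → b∉S y∈S }) e) walk bt

    module Obstruction {b b′} (B : Boundary b) (B′ : Boundary b′)
                       (b≢b′ : b ≢ b′) (¬bb′ : ¬ E τ b b′) where

      br : Bridge graph S b b′
      br = bridge graph S-connected (proj₁ B) (proj₁ B′) b≢b′ (¬bb′ ∘ region-τ (inj₂ B) (inj₂ B′))
        (proj₁ (proj₂ (proj₂ B)))  (E⇒Adj τ (proj₂ (proj₂ (proj₂ B))))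
        (proj₁ (proj₂ (proj₂ B′))) (E⇒Adj τ (proj₂ (proj₂ (proj₂ B′))))

      open Bridge br

      p-region : ∀ i → Region (p i)
      p-region i with place i
      ... | at-start e      = inj₂ (subst Boundary (sym (first e)) B)
      ... | at-end e        = inj₂ (subst Boundary (sym (last e)) B′)
      ... | between i≢0 i≢k = inj₁ (interior i≢0 i≢k)

      p-τ : ∀ i j → E τ (p i) (p j) ⇔ Consecutive i j
      p-τ i j = mk⇔ (to (adj i j) ∘ E⇒Adj τ) (region-τ (p-region i) (p-region j) ∘ from (adj i j))

      p-no-σ : ∀ i j → ¬ E σ (p i) (p j)
      p-no-σ i j = region-no-σ (p-region i) (p-region j)

      p-inside : ∀ {i w} → toℕ i ≢ 0 → toℕ i ≢ k → E σ s w → E σ w (p i)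
      p-inside i≢0 i≢k sw = E-sym σ (s⊑S (interior i≢0 i≢k) _ sw)

      -- In the interior the edge to `w` already has sign σ; at either end a τ-edge would, by
      -- `spread`, make `b` and `b′` adjacent.
      apex-no-τ : ∀ {w} i → E σ s w → ¬ E τ (p i) w
      apex-no-τ {w} i sw pw with place i
      ... | between i≢0 i≢k = clash (p-inside i≢0 i≢k sw) (E-sym τ pw)
      ... | at-start e = ¬bb′ (spread sw (subst (E τ w) (first e) (E-sym τ pw)) B B′ b≢b′)
      ... | at-end e   = ¬bb′ (E-sym τ
        (spread sw (subst (E τ w) (last e) (E-sym τ pw)) B′ B (b≢b′ ∘ sym)))

      module Apexes {m} (r : Fin m → Fin n) (r-inj : Injective _≡_ _≡_ r) (sr : ∀ j → E σ s (r j))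
                    (r-no-τ : ∀ i j → ¬ E τ (r i) (r j)) where

        q : Fin (suc k) ⊎ Fin m → Fin n
        q = [ p , r ]′

        p≢r : ∀ i j → p i ≢ r j
        p≢r i j e = region-off (p-region i) (subst (E σ s) (sym e) (sr j))

        q-inj : Injective _≡_ _≡_ q
        q-inj {inj₁ i} {inj₁ j} e = cong inj₁ (inj e)
        q-inj {inj₁ i} {inj₂ j} e = contradiction e (p≢r i j)
        q-inj {inj₂ i} {inj₁ j} e = contradiction (sym e) (p≢r j i)
        q-inj {inj₂ i} {inj₂ j} e = cong inj₂ (r-inj e)

        paths : ∀ x y → E (opposite σ) (q x) (q y) ⇔ SymClosure PathEdge x y
        paths = subst (λ ρ → ∀ x y → E ρ (q x) (q y) ⇔ SymClosure PathEdge x y) (sym opp) λ where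
          (inj₁ i) (inj₁ j) → mk⇔ (consecutive⇒path ∘ to (p-τ i j))
                                  (from (p-τ i j) ∘ path⇒consecutive)
          (inj₁ i) (inj₂ j) → neither (apex-no-τ i (sr j)) λ { (fwd ()) ; (bwd ()) }
          (inj₂ i) (inj₁ j) → neither (apex-no-τ j (sr i) ∘ E-sym τ) λ { (fwd ()) ; (bwd ()) }
          (inj₂ i) (inj₂ j) → neither (r-no-τ i j) λ { (fwd ()) ; (bwd ()) }

      ≢0⇒1≤ : ∀ {i : Fin (suc k)} → toℕ i ≢ 0 → 1 ≤ toℕ i
      ≢0⇒1≤ i≢0 = ℕ.n≢0⇒n>0 i≢0

      ≢k⇒<k : ∀ {i : Fin (suc k)} → toℕ i ≢ k → suc (toℕ i) < suc k
      ≢k⇒<k {i} i≢k = s≤s (ℕ.≤∧≢⇒< (toℕ≤pred[n] i) i≢k)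

      -- The interior vertices of the bridge lie in `S` and are therefore σ-adjacent to `w`. If both
      -- ends missed `w`, the bridge with apex `w` would be a mountain.
      no-mountain : ∀ {w} → E σ s w → E σ b w ⊎ E σ b′ w
      no-mountain {w} sw with E? σ b w | E? σ b′ w
      ... | yes bw | _      = inj₁ bw
      ... | no _   | yes b′w = inj₂ b′w
      ... | no ¬bw | no ¬b′w = ⊥-elim (mountain⇒¬C3 (s≤s 2≤k) q q-inj paths spokes c3)
        where
        r : Fin 1 → Fin n
        r _ = w
        r-inj : Injective _≡_ _≡_ r
        r-inj {0F} {0F} _ = refl
        open Apexes r r-inj (λ _ → sw) (λ _ _ → E-irrefl τ)
        spoke⁺ : ∀ i → E σ w (p i) → MountainEdge (inj₂ 0F) (inj₁ i)
        spoke⁺ i e with place i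
        ... | at-start i≡0    = contradiction (E-sym σ (subst (E σ w) (first i≡0) e)) ¬bw
        ... | at-end i≡k      = contradiction (E-sym σ (subst (E σ w) (last i≡k) e)) ¬b′w
        ... | between i≢0 i≢k = spoke (≢0⇒1≤ i≢0) (≢k⇒<k i≢k)
        spoke⁻ : ∀ {i} → SymClosure MountainEdge (inj₂ 0F) (inj₁ i) → E σ w (p i)
        spoke⁻ (fwd (spoke 1≤i i<k)) = p-inside (ℕ.>⇒≢ 1≤i) (ℕ.<⇒≢ (ℕ.s<s⁻¹ i<k)) sw
        spokes : ∀ x y → E σ (q x) (q y) ⇔ SymClosure MountainEdge x y
        spokes (inj₁ i)  (inj₁ j)  = neither (p-no-σ i j) λ { (fwd ()) ; (bwd ()) }
        spokes (inj₁ i)  (inj₂ 0F) = mk⇔ (bwd ∘ spoke⁺ i ∘ E-sym σ) (E-sym σ ∘ spoke⁻ ∘ symmetric _)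
        spokes (inj₂ 0F) (inj₁ j)  = mk⇔ (fwd ∘ spoke⁺ j) spoke⁻
        spokes (inj₂ 0F) (inj₂ 0F) = neither (E-irrefl σ) λ { (fwd ()) ; (bwd ()) }

      no-hill : ∀ {w₁ w₂} → E σ s w₁ → E σ s w₂ → E σ b w₁ → E σ b′ w₂ →
                ¬ E σ b′ w₁ → ¬ E σ b w₂ → ⊥
      no-hill {w₁} {w₂} sw₁ sw₂ bw₁ b′w₂ ¬b′w₁ ¬bw₂ =
        hill⇒¬C3 (ℕ.m≤n⇒m≤1+n 2≤k) q q-inj paths spokes c3
        where
        t∈S = proj₁ (proj₂ (proj₂ B))
        bt  = proj₂ (proj₂ (proj₂ B))
        w₁≢w₂ : w₁ ≢ w₂
        w₁≢w₂ refl = ¬bw₂ bw₁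
        -- The top edge comes from `C2` on `w₁ b t w₂`, where `t` is a τ-neighbour of `b` in `S`.
        w₁w₂ : E σ w₁ w₂
        w₁w₂ = cross w₁≢w₂ (E-sym σ bw₁) bt (s⊑S t∈S _ sw₂)
        r : Fin 2 → Fin n
        r 0F = w₁
        r 1F = w₂
        r-inj : Injective _≡_ _≡_ r
        r-inj {0F} {0F} _ = refl
        r-inj {0F} {1F} e = contradiction e w₁≢w₂
        r-inj {1F} {0F} e = contradiction (sym e) w₁≢w₂
        r-inj {1F} {1F} _ = refl
        sr : ∀ j → E σ s (r j)
        sr 0F = sw₁
        sr 1F = sw₂
        r-no-τ : ∀ i j → ¬ E τ (r i) (r j)
        r-no-τ 0F 0F = E-irrefl τ
        r-no-τ 0F 1F = clash w₁w₂
        r-no-τ 1F 0F = clash (E-sym σ w₁w₂)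
        r-no-τ 1F 1F = E-irrefl τ
        open Apexes r r-inj sr r-no-τ
        spoke₁⁺ : ∀ i → E σ w₁ (p i) → HillEdge (inj₂ 0F) (inj₁ i)
        spoke₁⁺ i e with place i
        ... | at-start i≡0  = spoke₁ (≢k⇒<k (λ i≡k → ℕ.m<n⇒n≢0 2≤k (trans (sym i≡k) i≡0)))
        ... | at-end i≡k    = contradiction (E-sym σ (subst (E σ w₁) (last i≡k) e)) ¬b′w₁
        ... | between _ i≢k = spoke₁ (≢k⇒<k i≢k)
        spoke₁⁻ : ∀ {i} → SymClosure HillEdge (inj₂ 0F) (inj₁ i) → E σ w₁ (p i)
        spoke₁⁻ {i} (fwd (spoke₁ i<k)) with place i
        ... | at-start i≡0    = subst (E σ w₁) (sym (first i≡0)) (E-sym σ bw₁)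
        ... | at-end i≡k      = contradiction i≡k (ℕ.<⇒≢ (ℕ.s<s⁻¹ i<k))
        ... | between i≢0 i≢k = p-inside i≢0 i≢k sw₁
        spoke₂⁺ : ∀ i → E σ w₂ (p i) → HillEdge (inj₂ 1F) (inj₁ i)
        spoke₂⁺ i e with place i
        ... | at-start i≡0  = contradiction (E-sym σ (subst (E σ w₂) (first i≡0) e)) ¬bw₂
        ... | at-end i≡k    = spoke₂ (≢0⇒1≤ (λ i≡0 → ℕ.m<n⇒n≢0 2≤k (trans (sym i≡k) i≡0)))
        ... | between i≢0 _ = spoke₂ (≢0⇒1≤ i≢0)
        spoke₂⁻ : ∀ {i} → SymClosure HillEdge (inj₂ 1F) (inj₁ i) → E σ w₂ (p i)
        spoke₂⁻ {i} (fwd (spoke₂ 1≤i)) with place i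
        ... | at-start i≡0    = contradiction i≡0 (ℕ.>⇒≢ 1≤i)
        ... | at-end i≡k      = subst (E σ w₂) (sym (last i≡k)) (E-sym σ b′w₂)
        ... | between i≢0 i≢k = p-inside i≢0 i≢k sw₂
        spokes : ∀ x y → E σ (q x) (q y) ⇔ SymClosure HillEdge x y
        spokes (inj₁ i)  (inj₁ j)  = neither (p-no-σ i j) λ { (fwd ()) ; (bwd ()) }
        spokes (inj₁ i)  (inj₂ 0F) = mk⇔ (bwd ∘ spoke₁⁺ i ∘ E-sym σ) (E-sym σ ∘ spoke₁⁻ ∘ symmetric _)
        spokes (inj₁ i)  (inj₂ 1F) = mk⇔ (bwd ∘ spoke₂⁺ i ∘ E-sym σ) (E-sym σ ∘ spoke₂⁻ ∘ symmetric _)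
        spokes (inj₂ 0F) (inj₁ j)  = mk⇔ (fwd ∘ spoke₁⁺ j) spoke₁⁻
        spokes (inj₂ 1F) (inj₁ j)  = mk⇔ (fwd ∘ spoke₂⁺ j) spoke₂⁻
        spokes (inj₂ 0F) (inj₂ 0F) = neither (E-irrefl σ) λ { (fwd ()) ; (bwd ()) }
        spokes (inj₂ 0F) (inj₂ 1F) = mk⇔ (λ _ → fwd top) (λ _ → w₁w₂)
        spokes (inj₂ 1F) (inj₂ 0F) = mk⇔ (λ _ → bwd top) (λ _ → E-sym σ w₁w₂)
        spokes (inj₂ 1F) (inj₂ 1F) = neither (E-irrefl σ) λ { (fwd ()) ; (bwd ()) }

      -- `w₁` is chosen to miss `b′` and `w₂` to miss `b`. Avoiding mountains forces the edges
      -- `b w₁` and `b′ w₂`, which complete a hill.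
      impossible : ⊥
      impossible with ⋢-witness (boundary⋢ B′) | ⋢-witness (boundary⋢ B)
      ... | w₁ , sw₁ , ¬b′w₁ | w₂ , sw₂ , ¬bw₂ with no-mountain sw₁ | no-mountain sw₂
      ...   | inj₂ b′w₁ | _         = ¬b′w₁ b′w₁
      ...   | inj₁ _    | inj₁ bw₂  = ¬bw₂ bw₂
      ...   | inj₁ bw₁  | inj₂ b′w₂ = no-hill sw₁ sw₂ bw₁ b′w₂ ¬b′w₁ ¬bw₂

    boundary-clique : ∀ {b b′} → Boundary b → Boundary b′ → b ≢ b′ → E τ b b′
    boundary-clique {b} {b′} B B′ b≢b′ with E? τ b b′
    ... | yes e = e
    ... | no ¬e = ⊥-elim (Obstruction.impossible B B′ b≢b′ ¬e)

    region? : Decidable Region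
    region? x = (x ∈? S) ⊎-dec boundary? x

    W K : Subset n
    W = comprehension region?
    K = comprehension boundary?

    τ-NeighboursClique : Fin n → Set
    τ-NeighboursClique t = ∀ u v → u ≢ v → E τ t u → E τ t v → E τ u v

    simplicial⇒clique : ∀ {t} → t ∈ S → SimplicialIn graph W t → τ-NeighboursClique t
    simplicial⇒clique t∈S (_ , clique) u v u≢v tu tv =
      region-τ Ru Rv (clique (∈-comprehension⁺ region? Ru , E⇒Adj τ tu)
                             (∈-comprehension⁺ region? Rv , E⇒Adj τ tv) u≢v)
      where
      Ru = neighbour-region t∈S tu
      Rv = neighbour-region t∈S tv

    -- All σ-neighbours of `t` are σ-neighbours of `s′`. For two of them, `u` and `v`, the path
    -- `u t s′ v` yields the edge `uv`. The τ-neighbourhoods of `t` and `v` are nested, and that of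
    -- `t` cannot lie in that of `v`, since `s′` is a τ-neighbour of `t` but a σ-neighbour of `v`.
    -- The conditions on τ-edges at `t` come from `clique` and from `region⊑`.
    removable-from-clique : ∀ {t s′} → t ∈ S → τ-NeighboursClique t →
                            E τ t s′ → s ⊑[ σ ] s′ → Removable t
    removable-from-clique {t} {s′} t∈S clique ts′ s⊑s′ = good⇒removable opp
      ( (λ u v u≢v tu tv → cross u≢v (E-sym σ tu) ts′ (t⊑s′ v tv))
      , (λ v tv → [ (λ t⊑v → contradiction (t⊑v s′ ts′) (clash (E-sym σ (t⊑s′ v tv)))) , id ]′
                  (τσ.nested tv)) )
      ( clique
      , (λ v tv → ⊑-trans (region⊑ (neighbour-region t∈S tv)) (s⊑S t∈S)) )
      where
      t⊑s′ : t ⊑[ σ ] s′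
      t⊑s′ = ⊑-trans (S⊑s t∈S) s⊑s′

    -- The predecessor of `t` on a climb from `s` serves as `s′`.
    root-or-climbed : ∀ {t} → t ∈ S → t ≡ s ⊎ ∃ λ s′ → E τ t s′ × s ⊑[ σ ] s′
    root-or-climbed t∈S = star-invariant (λ t → t ≡ s ⊎ ∃ λ s′ → E τ t s′ × s ⊑[ σ ] s′)
      (λ ((e , _) , x∈S , _) _ → inj₂ (_ , E-sym τ e , s⊑S x∈S)) (proj₂ connected t∈S) (inj₁ refl)

    -- The boundary is a clique that misses `s`, so some simplicial vertex of `W` lies in `S`; it is
    -- `s` or it is removable.
    root-clique : (∀ w → ¬ Removable w) → ¬ ¬ τ-NeighboursClique s
    root-clique none ¬clique = simplicial-outside-clique graph chordal {W} {K} {s}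
      (λ b∈ b′∈ b≢b′ → E⇒Adj τ (boundary-clique (∈-comprehension⁻ boundary? b∈)
                                                (∈-comprehension⁻ boundary? b′∈) b≢b′))
      (∈-comprehension⁺ region? (inj₁ (proj₁ connected)))
      (λ s∈K → proj₁ (∈-comprehension⁻ boundary? s∈K) (proj₁ connected))
      no-simplicial
      where
      no-simplicial : ∀ t → t ∉ K → ¬ SimplicialIn graph W t
      no-simplicial t t∉K simp with ∈-comprehension⁻ region? (proj₁ simp)
      ... | inj₂ B = t∉K (∈-comprehension⁺ boundary? B)
      ... | inj₁ t∈S with root-or-climbed t∈S
      ...   | inj₁ refl = ¬clique (simplicial⇒clique t∈S simp)
      ...   | inj₂ (s′ , ts′ , s⊑s′) =
              none t (removable-from-clique t∈S (simplicial⇒clique t∈S simp) ts′ s⊑s′)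

-- Existence of a removable vertex

module _ {n : ℕ} (G : SignedGraph n) (chordal : Chordal (SignedGraph.graph G))
         (c2 : C2 G) (c3 : C3 G) (none : ∀ w → ¬ Signs.Removable G w) where
  open Signs G

  plateau⇒clique : ∀ {σ τ} (opp : opposite σ ≡ τ) {s} → Alternating.Plateau G c2 opp s →
                   ∀ u v → u ≢ v → E τ s u → E τ s v → E τ u v
  plateau⇒clique {σ} {τ} opp {s} P u v u≢v su sv with E? τ u v
  ... | yes e = e
  ... | no ¬e = ⊥-elim (component (Alternating.Climb G c2 opp s) s λ S connected closed →
          PlateauComponent.root-clique G chordal c2 c3 opp P S connected closed none
            λ clique → ¬e (clique u v u≢v su sv))

  module _ {σ τ} (opp : opposite σ ≡ τ) where

    private
      opp′ : opposite τ ≡ σ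
      opp′ = opposite-selfInverse opp

    open Alternating G c2 opp using (Plateau; climb-above)
    open module τσ = Alternating G c2 opp′ using () renaming (Plateau to Plateau′)

    -- `P` supplies all of `Good τ σ` and `P′` all of `Good σ τ`.
    no-double-plateau : ∀ {s} → Plateau s → ¬ Plateau′ s
    no-double-plateau {s} P P′ = none s (good⇒removable opp
      (plateau⇒clique opp′ P′ , λ _ → τσ.plateau-neighbour P′)
      (plateau⇒clique opp P , λ _ → Alternating.plateau-neighbour G c2 opp P))

    -- Induction towards larger τ-neighbourhoods. By `local-max` the τ-neighbourhood cannot grow
    -- along a climb with the signs exchanged, so it stays that of `s`, and `s` is a plateau for
    -- both signs.
    no-plateau : ∀ s → Acc (λ y x → x ⊏[ τ ] y) s → ¬ Plateau s
    no-plateau s (acc larger) P = no-double-plateau P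
      λ walk → proj₂ (star-invariant (λ d → s ⊑[ τ ] d × d ⊑[ τ ] s)
        (λ (xy , s⊑y) (s⊑x , x⊑s) → s⊑y , ⊑-trans (local-max s⊑x xy) x⊑s)
        walk (⊑-refl , ⊑-refl))
      where
      -- Otherwise take v with a maximal σ-neighbourhood: no climb from v leaves the set of such
      -- vertices, so v is a σ-plateau with a τ-neighbourhood larger than that of s.
      no-higher : ∀ {x} → s ⊑[ τ ] x → ∀ v → Acc (λ y x → x ⊏[ σ ] y) v →
                  E σ x v → ¬ ¬ v ⊑[ τ ] x
      no-higher {x} s⊑x v (acc larger-σ) xv v⋢x with τσ.nested xv
      ... | inj₂ v⊑x = v⋢x v⊑x
      ... | inj₁ x⊑v = no-plateau v
              (larger (⊑-trans s⊑x x⊑v , λ v⊑s → v⋢x (⊑-trans v⊑s s⊑x))) v-plateau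
        where
        Higher : Pred (Fin n) 0ℓ
        Higher d = E σ x d × ¬ d ⊑[ τ ] x
        -- `x` remains a σ-neighbour because the climb keeps the σ-neighbours of `v`. Were the
        -- τ-neighbourhood of `d` inside that of `x`, the edge from `x` to the preceding vertex `y`
        -- would have both signs.
        higher : ∀ {d} → Star (Alternating.Climb G c2 opp v) v d → Higher d
        higher walk = star-invariant Higher
          (λ (yd , v⊑d) (xy , _) → E-sym σ (v⊑d x (E-sym σ xv))
            , λ d⊑x → E-opposite opp xy (d⊑x _ (E-sym τ yd)))
          walk (xv , v⋢x)
        v-plateau : Plateau v
        v-plateau {d} walk with d ⊑[ σ ]? v
        ... | yes d⊑v = d⊑v
        ... | no  d⋢v = ⊥-elim (no-higher s⊑x d (larger-σ (climb-above walk , d⋢v))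
                                  (proj₁ (higher walk)) (proj₂ (higher walk)))

      local-max : ∀ {x v} → s ⊑[ τ ] x → E σ x v → v ⊑[ τ ] x
      local-max {x} {v} s⊑x xv with v ⊑[ τ ]? x
      ... | yes v⊑x = v⊑x
      ... | no  v⋢x = ⊥-elim (no-higher s⊑x v (⊐-wellFounded σ v) xv v⋢x)

    -- Induction towards larger σ-neighbourhoods: a climb to a strictly larger one would reach a
    -- vertex that is already excluded, so `s` is a plateau.
    no-vertex : ∀ s → Acc (λ y x → x ⊏[ σ ] y) s → ⊥
    no-vertex s (acc larger) = no-plateau s (⊐-wellFounded τ s) plateau
      where
      plateau : Plateau s
      plateau {d} walk with d ⊑[ σ ]? s
      ... | yes d⊑s = d⊑s
      ... | no  d⋢s = ⊥-elim (no-vertex d (larger (climb-above walk , d⋢s)))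

removable-vertex : ∀ {n} (G : SignedGraph (suc n)) → Chordal (SignedGraph.graph G) → C2 G → C3 G →
                   ∃ (Signs.Removable G)
removable-vertex G chordal c2 c3 with any? (Signs.removable? G)
... | yes found = found
... | no ¬found = ⊥-elim (no-vertex G chordal c2 c3 (λ w r → ¬found (w , r)) {⊕} refl
                    zero (Signs.⊐-wellFounded G ⊕ zero))

-- Construction of an elimination ordering

module _ {n k : ℕ} (ι : Fin k ↣ Fin n) where

  induced-chordal : ∀ {H : Graph n} → Chordal H → Chordal (inducedGraph H ι)
  induced-chordal chordal m 4≤m κ = chordal m 4≤m (ι ↣-∘ κ)

  induced-C2 : ∀ {G : SignedGraph n} → C2 G → C2 (induced G ι)
  induced-C2 c2 σ u v w x u≢v u≢w u≢x v≢w v≢x w≢x =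
    c2 σ _ _ _ _ (≢ u≢v) (≢ u≢w) (≢ u≢x) (≢ v≢w) (≢ v≢x) (≢ w≢x)
    where
    ≢ : ∀ {a b} → a ≢ b → Injection.to ι a ≢ Injection.to ι b
    ≢ a≢b = a≢b ∘ Injection.injective ι

  induced-C3 : ∀ {G : SignedGraph n} → C3 G → C3 (induced G ι)
  induced-C3 c3 m κ = c3 m (ι ↣-∘ κ)

without : ∀ {n} → Fin (suc n) → Fin n ↣ Fin (suc n)
without w = mk↣ {to = punchIn w} (punchIn-injective w _ _)

data Punched {n} (w : Fin (suc n)) : Fin (suc n) → Set where
  itself : Punched w w
  other  : ∀ i → Punched w (punchIn w i)

punched : ∀ {n} (w x : Fin (suc n)) → Punched w x
punched w x with w ≟ x
... | yes refl = itself
... | no  w≢x  = subst (Punched w) (punchIn-punchOut w≢x) (other (punchOut w≢x))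

-- `w` gets the last position: triples ending in `w` are settled by `removable`, and all others
-- avoid `w`, so that `seo` applies.
append-removable : ∀ {n} (G : SignedGraph (suc n)) {w} → Signs.Removable G w →
                   SignedEliminable (induced G (without w)) → SignedEliminable G
append-removable {n} G {w} removable (ν , seo) = ↔⇒⤖ π , seo⁺
  where
  open SignedGraph G
  ν↔ = ⤖⇒↔ ν
  π : Permutation (suc n) (suc n)
  π = insert w (fromℕ n) ν↔
  π-w : π ⟨$⟩ʳ w ≡ fromℕ n
  π-w with w ≟ w
  ... | yes _  = refl
  ... | no w≢w = contradiction refl w≢w
  w-last : ∀ x → ¬ (π ⟨$⟩ʳ w) Fin.< (π ⟨$⟩ʳ x)
  w-last x lt = ℕ.<⇒≱ lt (subst (λ i → (π ⟨$⟩ʳ x) Fin.≤ i) (sym π-w) (≤fromℕ _))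
  restrict : ∀ {i j} → (π ⟨$⟩ʳ punchIn w i) Fin.< (π ⟨$⟩ʳ punchIn w j) →
             Bijection.to ν i Fin.< Bijection.to ν j
  restrict {i} {j} lt = ℕ.≰⇒> λ νj≤νi → ℕ.<⇒≱
    (subst₂ Fin._<_ (insert-punchIn w (fromℕ n) ν↔ i) (insert-punchIn w (fromℕ n) ν↔ j) lt)
    (punchIn-mono-≤ (fromℕ n) _ _ νj≤νi)
  seo⁺ : IsSEO G (↔⇒⤖ π)
  seo⁺ u v x u≢v u≢x v≢x u<x v<x σ with punched w x | punched w u | punched w v
  ... | other x′ | itself   | _        = contradiction u<x (w-last x)
  ... | other x′ | other _  | itself   = contradiction v<x (w-last x)
  ... | other x′ | other u′ | other v′ =
    seo u′ v′ x′ (u≢v ∘ cong _) (u≢x ∘ cong _) (v≢x ∘ cong _) (restrict u<x) (restrict v<x) σ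
  ... | itself | _ | _ =
      (λ uw wv → proj₁ (removable {σ} refl) u v u≢v (E-sym σ uw) wv)
    -- In (E2) for σ the given edge at the last vertex has the opposite sign, hence `removable` is
    -- used at `opposite σ`.
    , (λ uv vw → E-sym σ (proj₂ (removable {opposite σ} (opposite-selfInverse refl))
                                v (E-sym _ vw) u (E-sym σ uv)))

C2∧C3⇒eliminable : ∀ n (G : SignedGraph n) → Chordal (SignedGraph.graph G) → C2 G → C3 G →
                   SignedEliminable G
C2∧C3⇒eliminable zero    G _ _ _ = ⤖-id _ , λ ()
C2∧C3⇒eliminable (suc n) G chordal c2 c3 with removable-vertex G chordal c2 c3
... | w , removable = append-removable G removable
        (C2∧C3⇒eliminable n (induced G ι) (induced-chordal ι {SignedGraph.graph G} chordal)
          (induced-C2 ι {G} c2) (induced-C3 ι {G} c3))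
  where
  ι = without w

-- Eliminable graphs satisfy C2 and C3

argmax : ∀ {k} (f : Fin (suc k) → ℕ) → ∃ λ i → ∀ j → f j ≤ f i
argmax {zero}  f = zero , λ { zero → ℕ.≤-refl }
argmax {suc k} f with argmax (f ∘ suc)
... | i , max with ℕ.≤-total (f zero) (f (suc i))
...   | inj₁ f₀≤fᵢ = suc i , λ { zero → f₀≤fᵢ ; (suc j) → max j }
...   | inj₂ fᵢ≤f₀ = zero , λ { zero → ℕ.≤-refl ; (suc j) → ℕ.≤-trans (max j) fᵢ≤f₀ }

module _ {n : ℕ} (G : SignedGraph n) (ν : Ordering n) (seo : IsSEO G ν) where
  open Signs G

  rank : Fin n → ℕ
  rank = toℕ ∘ Bijection.to ν

  module _ {σ τ} (opp : opposite σ ≡ τ) where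

    same-sign : ∀ {u v w} → u ≢ v → rank u < rank w → rank v < rank w →
                E σ w u → E σ w v → E σ u v
    same-sign u≢v u<w v<w wu wv = proj₁ (seo _ _ _ u≢v (λ { refl → E-irrefl σ wu })
      (λ { refl → E-irrefl σ wv }) u<w v<w σ) (E-sym σ wu) wv

    mixed-sign : ∀ {u v w} → rank u < rank w → rank v < rank w →
                 E τ w v → E σ v u → E σ w u
    mixed-sign {u} {v} {w} u<w v<w wv vu = E-sym σ (proj₂ (seo u v w
      (λ { refl → E-irrefl σ vu }) (λ { refl → E-opposite opp vu (E-sym τ wv) })
      (λ { refl → E-irrefl τ wv }) u<w v<w σ)
      (E-sym σ vu) (subst (λ ρ → E ρ v w) (sym opp) (E-sym τ wv)))

  Last : ∀ {A : Set} → (A → Fin n) → A → Set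
  Last q x = ∀ {y} → y ≢ x → rank (q y) < rank (q x)

  last-vertex : ∀ {A : Set} {k} (e : A → Fin (suc k)) (ι : Fin (suc k) → Fin n) →
    Injective _≡_ _≡_ (ι ∘ e) → (∀ i → ∃ λ x → e x ≡ i) → ∃ (Last (ι ∘ e))
  last-vertex e ι inj surj with argmax (rank ∘ ι)
  ... | i , max with surj i
  ...   | x , refl = x , λ {y} y≢x → ℕ.≤∧≢⇒< (max (e y))
            (λ r → y≢x (inj (Bijection.injective ν (toℕ-injective r))))

  module _ {σ τ} (opp : opposite σ ≡ τ) where

    private
      opp′ : opposite τ ≡ σ
      opp′ = opposite-selfInverse opp

    C2-last-end : ∀ {u v w x} → v ≢ x → rank v < rank u → rank w < rank u → rank x < rank u →
                  E σ u v → E τ v w → E σ w x → E σ u x × E σ v x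
    C2-last-end v≢x v<u w<u x<u uv vw wx = ux , same-sign opp v≢x v<u x<u uv ux
      where
      -- (E2) first turns `uv`, `vw` into a τ-edge `uw`, and then `uw`, `wx` into a σ-edge `ux`.
      ux = mixed-sign opp x<u w<u (mixed-sign opp′ w<u v<u uv vw) wx

    C2-last-middle : ∀ {u v w x} → u ≢ x → rank u < rank v → rank w < rank v → rank x < rank v →
                     E σ u v → E τ v w → E σ w x → E σ u x × E σ v x
    C2-last-middle u≢x u<v w<v x<v uv vw wx = same-sign opp u≢x u<v x<v (E-sym σ uv) vx , vx
      where
      vx = mixed-sign opp x<v w<v vw wx

  eliminable⇒C2 : C2 G
  eliminable⇒C2 σ u v w x u≢v u≢w u≢x v≢w v≢x w≢x uv vw wx =
    by-last (last-vertex id q q-inj λ i → i , refl)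
    where
    τ = opposite σ
    q : Fin 4 → Fin n
    q 0F = u
    q 1F = v
    q 2F = w
    q 3F = x
    q-inj : Injective _≡_ _≡_ q
    q-inj {0F} {0F} _ = refl
    q-inj {0F} {1F} e = contradiction e u≢v
    q-inj {0F} {2F} e = contradiction e u≢w
    q-inj {0F} {3F} e = contradiction e u≢x
    q-inj {1F} {0F} e = contradiction (sym e) u≢v
    q-inj {1F} {1F} _ = refl
    q-inj {1F} {2F} e = contradiction e v≢w
    q-inj {1F} {3F} e = contradiction e v≢x
    q-inj {2F} {0F} e = contradiction (sym e) u≢w
    q-inj {2F} {1F} e = contradiction (sym e) v≢w
    q-inj {2F} {2F} _ = refl
    q-inj {2F} {3F} e = contradiction e w≢x
    q-inj {3F} {0F} e = contradiction (sym e) u≢x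
    q-inj {3F} {1F} e = contradiction (sym e) v≢x
    q-inj {3F} {2F} e = contradiction (sym e) w≢x
    q-inj {3F} {3F} _ = refl
    xw = E-sym σ wx
    wv = E-sym τ vw
    vu = E-sym σ uv
    -- Reversing the path `u v w x` exchanges the two alternatives of `C2`, so the cases where `w`
    -- or `x` comes last reduce to the other two.
    reversed : E σ x u × E σ w u → (E σ u w × E σ u x) ⊎ (E σ u x × E σ v x)
    reversed (xu , wu) = inj₁ (E-sym σ wu , E-sym σ xu)
    by-last : ∃ (Last q) → (E σ u w × E σ u x) ⊎ (E σ u x × E σ v x)
    by-last (0F , l) = inj₂
      (C2-last-end refl v≢x (l {1F} λ ()) (l {2F} λ ()) (l {3F} λ ()) uv vw wx)
    by-last (1F , l) = inj₂
      (C2-last-middle refl u≢x (l {0F} λ ()) (l {2F} λ ()) (l {3F} λ ()) uv vw wx)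
    by-last (2F , l) = reversed
      (C2-last-middle refl (u≢x ∘ sym) (l {3F} λ ()) (l {1F} λ ()) (l {0F} λ ()) xw wv vu)
    by-last (3F , l) = reversed
      (C2-last-end refl (u≢w ∘ sym) (l {2F} λ ()) (l {1F} λ ()) (l {0F} λ ()) xw wv vu)

  module Enumerated {σ m k} (q : Fin m ⊎ Fin k → Fin n) (q-inj : Injective _≡_ _≡_ q)
    (paths : ∀ x y → E (opposite σ) (q x) (q y) ⇔ SymClosure PathEdge x y) where

    private
      τ = opposite σ
      opp′ : opposite τ ≡ σ
      opp′ = opposite-selfInverse refl

    τ-step : ∀ {i j : Fin m} → toℕ j ≡ suc (toℕ i) → E τ (q (inj₁ i)) (q (inj₁ j))
    τ-step e = from (paths _ _) (fwd (step e))

    τ-back : ∀ {i j : Fin m} → toℕ j ≡ suc (toℕ i) → E τ (q (inj₁ j)) (q (inj₁ i))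
    τ-back e = from (paths _ _) (bwd (step e))

    E⇒≢ : ∀ ρ {x y} → E ρ (q x) (q y) → y ≢ x
    E⇒≢ ρ e refl = E-irrefl ρ e

    forces : ∀ {ρ ρ′ x y z} → opposite ρ ≡ ρ′ → Last q x →
             E ρ′ (q x) (q y) → E ρ (q y) (q z) → E ρ (q x) (q z)
    forces {ρ} {ρ′} opp l xy yz = mixed-sign opp
      (l λ { refl → E-opposite opp yz (E-sym ρ′ xy) }) (l (E⇒≢ ρ′ xy)) xy yz

    successor : ∀ (i : Fin m) → suc (toℕ i) < m → ∃ λ (j : Fin m) → toℕ j ≡ suc (toℕ i)
    successor i i<m = fromℕ< i<m , toℕ-fromℕ< i<m

    predecessor : ∀ (i : Fin m) → toℕ i ≢ 0 → ∃ λ (j : Fin m) → toℕ i ≡ suc (toℕ j)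
    predecessor zero    0≢0 = contradiction refl 0≢0
    predecessor (suc i) _   = Fin.inject₁ i , cong suc (sym (toℕ-inject₁ i))

    -- (E1) at the last vertex would join its two path neighbours by a τ-edge, but their indices
    -- differ by two.
    interior-not-last : ∀ i → toℕ i ≢ 0 → suc (toℕ i) < m → ¬ Last q (inj₁ i)
    interior-not-last i i≢0 i<m l with predecessor i i≢0 | successor i i<m
    ... | p , i≡1+p | s , s≡1+i = not-step (to (paths (inj₁ p) (inj₁ s)) ps)
      where
      p≢s : q (inj₁ p) ≢ q (inj₁ s)
      p≢s e with q-inj e
      ... | refl = ℕ.<-irrefl (trans s≡1+i (cong suc i≡1+p)) (s≤s (ℕ.n≤1+n _))
      ps : E τ (q (inj₁ p)) (q (inj₁ s))
      ps = same-sign opp′ p≢s (l (E⇒≢ τ (τ-back i≡1+p))) (l (E⇒≢ τ (τ-step s≡1+i)))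
             (τ-back i≡1+p) (τ-step s≡1+i)
      2+p≡s : suc (suc (toℕ p)) ≡ toℕ s
      2+p≡s = trans (cong suc (sym i≡1+p)) (sym s≡1+i)
      not-step : ¬ SymClosure PathEdge (inj₁ p) (inj₁ s)
      not-step (fwd (step e)) = ℕ.1+n≢n (ℕ.suc-injective (trans 2+p≡s e))
      not-step (bwd (step e)) = ℕ.m≢1+n+m _ {2} (trans e (cong suc (sym 2+p≡s)))

  -- If the apex comes last, (E2) through the second path vertex forces a τ-edge to the first. If an
  -- end comes last, (E2) through its path neighbour forces a σ-edge to the apex. Neither edge
  -- exists.
  mountain-has-no-last : ∀ {σ m} → 3 ≤ m → (q : Fin m ⊎ Fin 1 → Fin n) → Injective _≡_ _≡_ q →
                 (∀ x y → E (opposite σ) (q x) (q y) ⇔ SymClosure PathEdge x y) →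
                 (∀ x y → E σ (q x) (q y) ⇔ SymClosure MountainEdge x y) → ¬ ∃ (Last q)
  mountain-has-no-last {σ} {m@(suc (suc (suc _)))} (s≤s (s≤s (s≤s _))) q q-inj paths spokes = λ where
      (inj₂ 0F , l) → apex-non-edge (to (paths (inj₂ 0F) (inj₁ 0F))
        (forces opp′ l (from (spokes (inj₂ 0F) (inj₁ 1F)) (fwd spoke-1)) (τ-back {0F} {1F} refl)))
      (inj₁ zero , l) → start-non-edge (to (spokes (inj₁ 0F) (inj₂ 0F))
        (forces refl l (τ-step {0F} {1F} refl) (from (spokes (inj₁ 1F) (inj₂ 0F)) (bwd spoke-1))))
      (inj₁ (suc i) , l) → later i l
    where
    open Enumerated {σ} q q-inj paths
    opp′ : opposite (opposite σ) ≡ σ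
    opp′ = opposite-selfInverse refl
    spoke-1 : MountainEdge (inj₂ 0F) (inj₁ 1F)
    spoke-1 = spoke (s≤s z≤n) (s≤s (s≤s (s≤s z≤n)))
    apex-non-edge : ¬ SymClosure (PathEdge {m} {1}) (inj₂ 0F) (inj₁ 0F)
    apex-non-edge (fwd ())
    apex-non-edge (bwd ())
    start-non-edge : ¬ SymClosure (MountainEdge {m}) (inj₁ 0F) (inj₂ 0F)
    start-non-edge (bwd (spoke () _))
    end-non-edge : ∀ {i} → ¬ suc (toℕ i) < m → ¬ SymClosure (MountainEdge {m}) (inj₁ i) (inj₂ 0F)
    end-non-edge i≮m (bwd (spoke _ i<m)) = i≮m i<m
    later : ∀ i → ¬ Last q (inj₁ (suc i))
    later i l with suc (suc (toℕ i)) ℕ.<? m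
    ... | yes i<m = interior-not-last (suc i) (λ ()) i<m l
    later zero l | no i≮m = i≮m (s≤s (s≤s (s≤s z≤n)))
    later (suc i) l | no i≮m with predecessor (suc (suc i)) (λ ())
    ... | p , i≡1+p = end-non-edge {suc (suc i)} i≮m (to (spokes (inj₁ (suc (suc i))) (inj₂ 0F))
      (forces refl l (τ-back i≡1+p) (from (spokes (inj₁ p) (inj₂ 0F)) (bwd spoke-p))))
      where
      spoke-p : MountainEdge (inj₂ 0F) (inj₁ p)
      spoke-p = spoke (subst (1 ≤_) (ℕ.suc-injective i≡1+p) (s≤s z≤n))
                      (subst (_< m) i≡1+p (toℕ<n (suc (suc i))))

  -- Each apex misses one end of the path. Whichever of the two comes last, (E2) through the path
  -- neighbour of that end forces the missing edge.
  hill-has-no-last : ∀ {σ m} → 2 ≤ m → (q : Fin m ⊎ Fin 2 → Fin n) → Injective _≡_ _≡_ q →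
             (∀ x y → E (opposite σ) (q x) (q y) ⇔ SymClosure PathEdge x y) →
             (∀ x y → E σ (q x) (q y) ⇔ SymClosure HillEdge x y) → ¬ ∃ (Last q)
  hill-has-no-last {σ} {m@(suc (suc m-2))} (s≤s (s≤s _)) q q-inj paths spokes = λ where
      (inj₂ 0F , l) → apex-non-edge 0F (to (paths (inj₂ 0F) (inj₁ end))
        (forces opp′ l (from (spokes (inj₂ 0F) (inj₁ penultimate)) (fwd spoke-penultimate))
          (τ-step {penultimate} {end} (cong suc (trans (toℕ-fromℕ m-2) (sym toℕ-penultimate))))))
      (inj₂ 1F , l) → apex-non-edge 1F (to (paths (inj₂ 1F) (inj₁ 0F)) (forces opp′ l
        (from (spokes (inj₂ 1F) (inj₁ 1F)) (fwd (spoke₂ (s≤s z≤n)))) (τ-back {0F} {1F} refl)))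
      (inj₁ zero , l) → start-non-edge (to (spokes (inj₁ 0F) (inj₂ 1F))
        (forces refl l (τ-step {0F} {1F} refl)
          (from (spokes (inj₁ 1F) (inj₂ 1F)) (bwd (spoke₂ (s≤s z≤n))))))
      (inj₁ (suc i) , l) → later i l
    where
    open Enumerated {σ} q q-inj paths
    opp′ : opposite (opposite σ) ≡ σ
    opp′ = opposite-selfInverse refl
    penultimate end : Fin m
    penultimate = Fin.inject₁ (fromℕ m-2)
    end = suc (fromℕ m-2)
    toℕ-penultimate : toℕ penultimate ≡ m-2
    toℕ-penultimate = trans (toℕ-inject₁ _) (toℕ-fromℕ _)
    spoke-penultimate : HillEdge (inj₂ 0F) (inj₁ penultimate)
    spoke-penultimate = spoke₁ (s≤s (subst (_< suc m-2) (sym toℕ-penultimate) ℕ.≤-refl))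
    apex-non-edge : ∀ j {i} → ¬ SymClosure (PathEdge {m} {2}) (inj₂ j) (inj₁ i)
    apex-non-edge _ (fwd ())
    apex-non-edge _ (bwd ())
    start-non-edge : ¬ SymClosure (HillEdge {m}) (inj₁ 0F) (inj₂ 1F)
    start-non-edge (bwd (spoke₂ ()))
    end-non-edge : ∀ {i} → ¬ suc (toℕ i) < m → ¬ SymClosure (HillEdge {m}) (inj₁ i) (inj₂ 0F)
    end-non-edge i≮m (bwd (spoke₁ i<m)) = i≮m i<m
    later : ∀ i → ¬ Last q (inj₁ (suc i))
    later i l with suc (suc (toℕ i)) ℕ.<? m
    ... | yes i<m = interior-not-last (suc i) (λ ()) i<m l
    ... | no i≮m with predecessor (suc i) (λ ())
    ...   | p , i≡1+p = end-non-edge {suc i} i≮m (to (spokes (inj₁ (suc i)) (inj₂ 0F))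
      (forces refl l (τ-back i≡1+p)
        (from (spokes (inj₁ p) (inj₂ 0F)) (bwd (spoke₁ (subst (_< m) i≡1+p (toℕ<n (suc i))))))))

  eliminable⇒C3 : C3 G
  eliminable⇒C3 k ι = no-m , no-h
    where
    -- `x` rules out `k = 0`. The ordering of `G` is evaluated on the embedded vertices, so none is
    -- formed on the induced subgraph.
    last : ∀ {A : Set} {k} (x : A) (e : A ⤖ Fin k) (ι : Fin k ↣ Fin n) →
           ∃ (Last (Injection.to ι ∘ Bijection.to e))
    last {k = zero}  x e ι with () ← Bijection.to e x
    last {k = suc k} x e ι = last-vertex (Bijection.to e) (Injection.to ι)
      (Bijection.injective e ∘ Injection.injective ι)
      (Bijection.strictlySurjective e)
    no-m : ¬ IsMountain (induced G ι)
    no-m (σ , m , 3≤m , e , paths , spokes) = mountain-has-no-last {σ} 3≤m _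
      (Bijection.injective e ∘ Injection.injective ι) paths spokes (last (inj₂ 0F) e ι)
    no-h : ¬ IsHill (induced G ι)
    no-h (σ , m , 2≤m , e , paths , spokes) = hill-has-no-last {σ} 2≤m _
      (Bijection.injective e ∘ Injection.injective ι) paths spokes (last (inj₂ 0F) e ι)

proposition6p2 : ∀ (n : ℕ) (G : SignedGraph n) → Chordal (SignedGraph.graph G) → SignedEliminable G ⇔ (C2 G × C3 G)
proposition6p2 n G chordal = mk⇔
  (λ (ν , seo) → eliminable⇒C2 G ν seo , eliminable⇒C3 G ν seo)
  (λ (c2 , c3) → C2∧C3⇒eliminable n G chordal c2 c3)
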